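{- Let $F\subseteq E(K_n)$ be a set of $p\ge 1$ edges of the complete graph $K_n$ such that $K_n-F$ is connected. Let $Q$ be the edge-defect matrix of $F$ and let $\theta_1,\ldots,\theta_p$ be the eigenvalues of $Q$ with multiplicity, including zero eigenvalues. Then $$Kf(K_n-F)=n-1+\operatorname{tr}\left(Q(nI_p-Q)^{ -1}\right)=n-1+\sum_{\alpha=1}^{p}\frac{\theta_\alpha}{n-\theta_\alpha}.$$
   Context: $K_n-F$ is the graph on the vertices of $K_n$ obtained by deleting the edges in $F=\{e_1,\ldots,e_p\}$. For each deleted edge $e_\alpha=\{u_\alpha,v_\alpha\}$ choose an arbitrary orientation and put $b_\alpha=e_{u_\alpha}-e_{v_\alpha}\in\mathbb{R}^n$, where $e_x$ is the standard basis vector of vertex $x$; put $B=[\,b_1\ \cdots\ b_p\,]$ (an $n\times p$ matrix). The edge-defect matrix of $F$ is the $p\times p$ matrix $Q=B^TB$. For a connected graph $G$ with Laplacian $L(G)=D(G)-A(G)$, the effective resistance between distinct vertices is $R_G(x,y)=(e_x-e_y)^TL(G)^+(e_x-e_y)$ ($L(G)^+$ the Moore--Penrose inverse), and the Kirchhoff index is $Kf(G)=\sum_{\{x,y\}}R_G(x,y)$, the sum over all unordered pairs of distinct vertices. -}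

module Defs where

open import Level using (Level; 0ℓ; suc; _⊔_)
open import Algebra.Apartness.Bundles using (HeytingField; HeytingCommutativeRing)
open import Algebra.Bundles using (CommutativeRing; Semiring)
import Algebra.Definitions
import Algebra.Definitions.RawSemiring
open import Data.Bool.Base using (if_then_else_)
open import Data.Fin.Base using (Fin; zero; toℕ; punchIn) renaming (suc to fsuc)
open import Data.Fin.Properties using (_≟_; _<?_; any?)
open import Data.Nat.Base using (ℕ)
open import Data.Product.Base using (∃; _×_; _,_; proj₁; proj₂)
open import Data.Sum.Base using (_⊎_; inj₁; inj₂)
open import Data.Vec.Functional using (Vector; transpose)
open import Function.Base using (_∘_)
open import Function.Bundles using (_⇔_)
open import Relation.Binary.Core using (Rel)
open import Relation.Binary.Construct.Closure.ReflexiveTransitive using (Star)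
open import Relation.Binary.Definitions using (Decidable; Symmetric)
open import Relation.Binary.PropositionalEquality.Core using (_≡_; _≢_; refl; sym)
open import Relation.Binary.Structures using (IsStrictPartialOrder)
open import Relation.Nullary.Decidable.Core using (does; ¬?; _×-dec_; _⊎-dec_)
open import Relation.Nullary.Negation.Core using (¬_)

-- The library has no real numbers; they enter as one instance of this
-- structure.  Neither _≈_ nor _<_ is assumed decidable, so constructive
-- models of ℝ qualify as well as ℚ.  Cotransitivity of _<_ and 0 < 1 are
-- consequences of the fields below.
record OrderedField c ℓ₁ ℓ₂ ℓ₃ : Set (suc (c ⊔ ℓ₁ ⊔ ℓ₂ ⊔ ℓ₃)) where
  field
    heytingField : HeytingField c ℓ₁ ℓ₂

  open HeytingField heytingField public
  open HeytingCommutativeRing heytingCommutativeRing public using (commutativeRing)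

  infix 4 _<_
  field
    _<_                  : Rel Carrier ℓ₃
    isStrictPartialOrder : IsStrictPartialOrder _≈_ _<_
    #⇔<⊎>                : ∀ x y → (x # y) ⇔ (x < y ⊎ y < x)
    +-monoˡ-<            : ∀ z {x y} → x < y → x + z < y + z
    *-pos                : ∀ {x y} → 0# < x → 0# < y → 0# < x * y

record SimpleGraph (n : ℕ) : Set₁ where
  infix 4 _~_ _~?_
  field
    _~_      : Rel (Fin n) 0ℓ
    _~?_     : Decidable _~_
    ~-sym    : Symmetric _~_
    ~-irrefl : ∀ x → ¬ (x ~ x)

Connected : ∀ {n} → SimpleGraph n → Set
Connected G = ∀ x y → Star _~_ x y
  where open SimpleGraph G

complete : ∀ n → SimpleGraph n
complete n = record
  { _~_      = _≢_
  ; _~?_     = λ x y → ¬? (x ≟ y)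
  ; ~-sym    = λ x≢y y≡x → x≢y (sym y≡x)
  ; ~-irrefl = λ x x≢x → x≢x refl
  }

-- A set of p edges of the complete graph on Fin n, enumerated by Fin p and
-- with an orientation (u α , v α) chosen for each edge.  Distinct indices
-- name distinct unordered pairs.
record EdgeSet (n p : ℕ) : Set where
  field
    u v : Fin p → Fin n

  Joins : Fin p → Fin n → Fin n → Set
  Joins α x y = (u α ≡ x × v α ≡ y) ⊎ (u α ≡ y × v α ≡ x)

  field
    loopless : ∀ α → u α ≢ v α
    distinct : ∀ α β → Joins α (u β) (v β) → α ≡ β

infixl 6 _∖_

_∖_ : ∀ {n p} → SimpleGraph n → EdgeSet n p → SimpleGraph n
G ∖ F = record
  { _~_      = λ x y → x ~ y × ¬ (∃ λ α → Joins α x y)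
  ; _~?_     = λ x y → (x ~? y) ×-dec ¬? (any? λ α →
                 ((u α ≟ x) ×-dec (v α ≟ y)) ⊎-dec ((u α ≟ y) ×-dec (v α ≟ x)))
  ; ~-sym    = λ { (x~y , kept) → ~-sym x~y , λ { (α , j) → kept (α , flipJoins j) } }
  ; ~-irrefl = λ x x~x → ~-irrefl x (proj₁ x~x)
  }
  where
  open SimpleGraph G
  open EdgeSet F
  flipJoins : ∀ {α x y} → Joins α x y → Joins α y x
  flipJoins (inj₁ p) = inj₂ p
  flipJoins (inj₂ p) = inj₁ p

module Over {c ℓ₁ ℓ₂ ℓ₃} (K : OrderedField c ℓ₁ ℓ₂ ℓ₃) where

  open OrderedField K public
    using (Carrier; _≈_; _#_; _+_; _*_; -_; _-_; 0#; 1#; #⇒invertible)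

  open Algebra.Definitions.RawSemiring
    (Semiring.rawSemiring (CommutativeRing.semiring (OrderedField.commutativeRing K)))
    public using (sum; product; _^_) renaming (_×_ to _·_)

  fromℕ : ℕ → Carrier
  fromℕ n = n · 1#

  -- The inverse of the difference x - y of two apart elements.
  recip-diff : ∀ {x y} → x # y → Carrier
  recip-diff x#y = proj₁ (#⇒invertible x#y)

  Matrix : ℕ → ℕ → Set c
  Matrix m n = Vector (Vector Carrier n) m

  infix  4 _≈ᴹ_
  infixl 6 _-ᴹ_
  infixl 7 _*ᴹ_ _·ᴹ_

  _≈ᴹ_ : ∀ {m n} → Rel (Matrix m n) ℓ₁
  A ≈ᴹ B = ∀ i j → A i j ≈ B i j

  _-ᴹ_ : ∀ {m n} → Matrix m n → Matrix m n → Matrix m n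
  (A -ᴹ B) i j = A i j - B i j

  _·ᴹ_ : ∀ {m n} → Carrier → Matrix m n → Matrix m n
  (a ·ᴹ A) i j = a * A i j

  _*ᴹ_ : ∀ {l m n} → Matrix l m → Matrix m n → Matrix l n
  (A *ᴹ B) i k = sum λ j → A i j * B j k

  basis : ∀ {n} → Fin n → Vector Carrier n
  basis x i = if does (x ≟ i) then 1# else 0#

  1ᴹ : ∀ {n} → Matrix n n
  1ᴹ = basis

  tr : ∀ {n} → Matrix n n → Carrier
  tr A = sum λ i → A i i

  det : ∀ {n} → Matrix n n → Carrier
  det {ℕ.zero}  A = 1#
  det {ℕ.suc n} A =
    sum λ j → (- 1#) ^ toℕ j * A zero j * det (λ i k → A (fsuc i) (punchIn j k))

  Invertibleᴹ : ∀ {n} → Matrix n n → Set (c ⊔ ℓ₁)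
  Invertibleᴹ {n} = Algebra.Definitions.Invertible (_≈ᴹ_ {n} {n}) 1ᴹ _*ᴹ_

  -- θ lists the eigenvalues of A with algebraic multiplicity: the
  -- characteristic polynomial of A is the product of the X - θ α.  An ordered
  -- field is infinite, so equality of these polynomials is equality of their
  -- values.
  IsSpectrum : ∀ {n} → Matrix n n → Vector Carrier n → Set (c ⊔ ℓ₁)
  IsSpectrum A θ = ∀ x → det (x ·ᴹ 1ᴹ -ᴹ A) ≈ product λ α → x - θ α

  record MoorePenroseInverse {m n} (A : Matrix m n) : Set (c ⊔ ℓ₁) where
    field
      A⁺        : Matrix n m
      AA⁺A≈A    : A *ᴹ A⁺ *ᴹ A ≈ᴹ A
      A⁺AA⁺≈A⁺  : A⁺ *ᴹ A *ᴹ A⁺ ≈ᴹ A⁺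
      AA⁺-symm  : transpose (A *ᴹ A⁺) ≈ᴹ A *ᴹ A⁺
      A⁺A-symm  : transpose (A⁺ *ᴹ A) ≈ᴹ A⁺ *ᴹ A

  module _ {n p} (F : EdgeSet n p) where
    open EdgeSet F

    incidence : Matrix n p
    incidence i α = basis (u α) i - basis (v α) i

    edgeDefect : Matrix p p
    edgeDefect = transpose incidence *ᴹ incidence

  module _ {n} (G : SimpleGraph n) where
    open SimpleGraph G

    adjacency : Matrix n n
    adjacency x y = if does (x ~? y) then 1# else 0#

    degrees : Matrix n n
    degrees x y = if does (x ≟ y) then sum (adjacency x) else 0#

    laplacian : Matrix n n
    laplacian = degrees -ᴹ adjacency

  module _ {n} (G : SimpleGraph n) (L⁺ : MoorePenroseInverse (laplacian G)) where
    open MoorePenroseInverse L⁺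

    resistance : Fin n → Fin n → Carrier
    resistance x y = sum λ i → sum λ j → d i * A⁺ i j * d j
      where
      d : Vector Carrier n
      d i = basis x i - basis y i

    kirchhoffIndex : Carrier
    kirchhoffIndex =
      sum λ x → sum λ y → if does (x <? y) then resistance x y else 0#

{-# OPTIONS --safe #-}

-- Let B be the incidence matrix of F, J the all-ones matrix and ν = n in the
-- field.  For G = K_n - F one has L(G) + J = ν - B Bᵀ =: N, and connectedness
-- makes N positive definite, hence invertible.  Inverses of N and of
-- M = ν - BᵀB = ν - Q determine each other: ν N⁻¹ = 1 + B M⁻¹ Bᵀ.  Since J is an
-- eigenprojection of N up to scale, L(G)⁺ = N⁻¹ - J/ν², and the rows of L(G)⁺
-- sum to 0, so Kf = ν tr L(G)⁺ = ν tr N⁻¹ - 1 = ν - 1 + tr (Q M⁻¹).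
--
-- Eigenvalues are given only through the values of the characteristic
-- polynomial.  Multiplicativity of det turns these into
-- det (1 + t M⁻¹) = ∏ (1 + t / (ν - θ α)) for all t, whose terms linear in t
-- give tr M⁻¹ = ∑ 1 / (ν - θ α).

module Submission where

open import Algebra.Bundles using (CommutativeRing; RawRing)
import Algebra.Solver.Ring
open import Algebra.Solver.Ring.AlmostCommutativeRing using (fromCommutativeRing; _-Raw-AlmostCommutative⟶_)
open import Data.Bool.Base using (true; false; if_then_else_)
open import Data.Empty using (⊥-elim)
open import Data.Fin.Base using (Fin; zero; suc; toℕ; punchIn)
open import Data.Fin.Properties using (_≟_; _<?_; <-cmp; any?; suc-injective)
open import Data.Integer.Base as ℤ using (ℤ; -[1+_]; -1ℤ) renaming (+_ to pos)
import Data.Integer.Properties as ℤ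
import Data.List.Base as List
import Data.List.Relation.Unary.All as All
open import Data.Maybe.Base as Maybe using ()
open import Data.Nat.Base as ℕ using (ℕ; zero; suc; NonZero; s<s; _≤_)
import Data.Nat.Properties as ℕ
open import Data.Product.Base using (_×_; _,_; proj₁; proj₂; ∃; Σ-syntax)
open import Data.Sign.Base using (Sign)
open import Data.Sum.Base using (_⊎_; inj₁; inj₂)
open import Data.Unit.Base using (⊤)
open import Data.Vec.Functional as Vector using (Vector; transpose)
open import Function.Base using (_∘_)
open import Function.Bundles using (Equivalence; mk⇔)
open import Level using (_⊔_; Lift)
open import Relation.Binary.Bundles using (Setoid)
open import Relation.Binary.Construct.Closure.ReflexiveTransitive using (Star; ε; _◅_)
open import Relation.Binary.Definitions using (tri<; tri≈; tri>)
open import Relation.Binary.PropositionalEquality.Core as ≡ using (_≡_; _≢_)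
import Relation.Binary.Reasoning.Setoid
open import Relation.Binary.Structures using (IsStrictPartialOrder)
open import Relation.Nullary.Decidable
  using (Dec; yes; no; does; does-⇔; dec-true; dec-false; dec⇒maybe; _×-dec_; _⊎-dec_)
open import Relation.Nullary.Negation.Core using (¬_)
open import Defs

-- Equality and order in the field are undecidable, so no step may ask whether an element is zero.
-- Apartness replaces inequality, `¬ (x < 0#)` replaces nonnegativity, and "some summand is nonzero"
-- is extracted from cotransitivity. Invertibility of N therefore comes from elimination on positive
-- pivots rather than from a trivial kernel. The passage between N and M rests on the intertwining
-- (a - BA) B = B (a - AB). For the spectral form, A (a - A)⁻¹ = a (a - A)⁻¹ - 1 and its scalar
-- analogue θ / (a - θ) = a / (a - θ) - 1 reduce both expressions to tr M⁻¹ and ∑ 1 / (ν - θ α).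
-- Comparing linear terms of two functions known only by their values needs two facts: both are
-- polynomial in t, and a polynomial with only zero values has zero coefficients. On the determinant
-- side the linear term is the derivative of `det` at the identity, which is the trace.
-- Multiplicativity of `det`, defined by expansion along the first row, comes from its being
-- alternating in the columns: any alternating function of n combinations of n vectors is a
-- determinant times its value at those vectors.

private variable
  k l m n p : ℕ

-- Ring normalisation with integer coefficients.

module IntegerCoefficients {c ℓ} (R : CommutativeRing c ℓ) where

  open CommutativeRing R
  open import Algebra.Properties.Ring ring using (-‿distribˡ-*; -‿distribʳ-*; -0#≈0#; -‿involutive)
  open import Algebra.Properties.AbelianGroup +-abelianGroup using (⁻¹-∙-comm)
  open import Algebra.Properties.Semiring.Mult.TCOptimised semiring using (×-homo-+; ×1-homo-*; 1+×) renaming (_×_ to _·′_)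
  open import Relation.Binary.Reasoning.Setoid setoid

  -- With the optimised multiple, `1 ·′ 1#` computes to `1#`, so the solver constants 0, 1, -1 and 2
  -- are literally `0#`, `1#`, `- 1#` and `1# + 1#` in the goals.
  fromℤ : ℤ → Carrier
  fromℤ (pos n)  = n ·′ 1#
  fromℤ -[1+ n ] = - (suc n ·′ 1#)

  fromℤ-⊖ : ∀ m n → fromℤ (m ℤ.⊖ n) ≈ m ·′ 1# - n ·′ 1#
  fromℤ-⊖ m       zero    = sym (trans (+-congˡ -0#≈0#) (+-identityʳ _))
  fromℤ-⊖ zero    (suc n) = sym (+-identityˡ _)
  fromℤ-⊖ (suc m) (suc n) = begin
    fromℤ (suc m ℤ.⊖ suc n)              ≡⟨ ≡.cong fromℤ (ℤ.[1+m]⊖[1+n]≡m⊖n m n) ⟩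
    fromℤ (m ℤ.⊖ n)                      ≈⟨ fromℤ-⊖ m n ⟩
    m ·′ 1# - n ·′ 1#                    ≈⟨ +-congʳ (+-identityˡ _) ⟨
    (0# + m ·′ 1#) - n ·′ 1#             ≈⟨ +-congʳ (+-congʳ (-‿inverseʳ 1#)) ⟨
    (1# - 1# + m ·′ 1#) - n ·′ 1#        ≈⟨ +-congʳ (trans (+-congʳ (+-comm _ _)) (trans (+-assoc _ _ _) (+-comm _ _))) ⟩
    (1# + m ·′ 1# - 1#) - n ·′ 1#        ≈⟨ +-assoc _ _ _ ⟩
    1# + m ·′ 1# + (- 1# - n ·′ 1#)      ≈⟨ +-congˡ (⁻¹-∙-comm _ _) ⟩
    1# + m ·′ 1# - (1# + n ·′ 1#)        ≈⟨ +-cong (1+× m 1#) (-‿cong (1+× n 1#)) ⟨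
    suc m ·′ 1# - suc n ·′ 1#            ∎

  fromℤ-homo-+ : ∀ i j → fromℤ (i ℤ.+ j) ≈ fromℤ i + fromℤ j
  fromℤ-homo-+ (pos m)  (pos n)  = ×-homo-+ 1# m n
  fromℤ-homo-+ (pos m)  -[1+ n ] = fromℤ-⊖ m (suc n)
  fromℤ-homo-+ -[1+ m ] (pos n)  = trans (fromℤ-⊖ n (suc m)) (+-comm _ _)
  fromℤ-homo-+ -[1+ m ] -[1+ n ] = begin
    - (suc (suc (m ℕ.+ n)) ·′ 1#)        ≡⟨ ≡.cong (λ k → - (suc k ·′ 1#)) (ℕ.+-suc m n) ⟨
    - ((suc m ℕ.+ suc n) ·′ 1#)          ≈⟨ -‿cong (×-homo-+ 1# (suc m) (suc n)) ⟩
    - (suc m ·′ 1# + suc n ·′ 1#)        ≈⟨ ⁻¹-∙-comm _ _ ⟨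
    - (suc m ·′ 1#) - suc n ·′ 1#        ∎

  fromℤ-neg : ∀ i → fromℤ (ℤ.- i) ≈ - fromℤ i
  fromℤ-neg (pos zero)    = sym -0#≈0#
  fromℤ-neg (pos (suc n)) = refl
  fromℤ-neg -[1+ n ]      = sym (-‿involutive _)

  fromℤ-homo-* : ∀ i j → fromℤ (i ℤ.* j) ≈ fromℤ i * fromℤ j
  fromℤ-homo-* (pos m) (pos n) = begin
    fromℤ (Sign.+ ℤ.◃ m ℕ.* n)   ≡⟨ ≡.cong fromℤ (ℤ.+◃n≡+n (m ℕ.* n)) ⟩
    (m ℕ.* n) ·′ 1#              ≈⟨ ×1-homo-* m n ⟩
    m ·′ 1# * n ·′ 1#            ∎
  fromℤ-homo-* (pos m) -[1+ n ] = begin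
    fromℤ (Sign.- ℤ.◃ m ℕ.* suc n) ≡⟨ ≡.cong fromℤ (ℤ.-◃n≡-n (m ℕ.* suc n)) ⟩
    fromℤ (ℤ.- pos (m ℕ.* suc n))  ≈⟨ fromℤ-neg (pos (m ℕ.* suc n)) ⟩
    - ((m ℕ.* suc n) ·′ 1#)        ≈⟨ -‿cong (×1-homo-* m (suc n)) ⟩
    - (m ·′ 1# * suc n ·′ 1#)      ≈⟨ -‿distribʳ-* _ _ ⟩
    m ·′ 1# * - (suc n ·′ 1#)      ∎
  fromℤ-homo-* -[1+ m ] (pos n) = begin
    fromℤ (Sign.- ℤ.◃ suc m ℕ.* n) ≡⟨ ≡.cong fromℤ (ℤ.-◃n≡-n (suc m ℕ.* n)) ⟩
    fromℤ (ℤ.- pos (suc m ℕ.* n))  ≈⟨ fromℤ-neg (pos (suc m ℕ.* n)) ⟩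
    - ((suc m ℕ.* n) ·′ 1#)        ≈⟨ -‿cong (×1-homo-* (suc m) n) ⟩
    - (suc m ·′ 1# * n ·′ 1#)      ≈⟨ -‿distribˡ-* _ _ ⟩
    - (suc m ·′ 1#) * n ·′ 1#      ∎
  fromℤ-homo-* -[1+ m ] -[1+ n ] = begin
    (suc m ℕ.* suc n) ·′ 1#               ≈⟨ ×1-homo-* (suc m) (suc n) ⟩
    suc m ·′ 1# * suc n ·′ 1#             ≈⟨ -‿involutive _ ⟨
    - - (suc m ·′ 1# * suc n ·′ 1#)       ≈⟨ -‿cong (-‿distribˡ-* _ _) ⟩
    - (- (suc m ·′ 1#) * suc n ·′ 1#)     ≈⟨ -‿distribʳ-* _ _ ⟩
    - (suc m ·′ 1#) * - (suc n ·′ 1#)     ∎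

  -- Coefficients in ℤ let the ring solver cancel terms although equality in R is
  -- not decidable.
  ℤ-rawRing : RawRing _ _
  ℤ-rawRing = record { _≈_ = _≡_ ; _+_ = ℤ._+_ ; _*_ = ℤ._*_ ; -_ = ℤ.-_ ; 0# = ℤ.0ℤ ; 1# = ℤ.1ℤ }

  fromℤ-morphism : ℤ-rawRing -Raw-AlmostCommutative⟶ fromCommutativeRing R
  fromℤ-morphism = record
    { ⟦_⟧    = fromℤ
    ; +-homo = fromℤ-homo-+
    ; *-homo = fromℤ-homo-*
    ; -‿homo = fromℤ-neg
    ; 0-homo = refl
    ; 1-homo = refl
    }

  module Solver = Algebra.Solver.Ring ℤ-rawRing (fromCommutativeRing R) fromℤ-morphism
    (λ i j → Maybe.map (λ i≡j → reflexive (≡.cong fromℤ i≡j)) (dec⇒maybe (i ℤ.≟ j)))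

-- Apartness, signs and invertibility in an ordered Heyting field.

module OrderedFieldProperties {c ℓ₁ ℓ₂ ℓ₃} (K : OrderedField c ℓ₁ ℓ₂ ℓ₃) where

  open OrderedField K hiding (zero)
  open Over K using (fromℕ; sum; recip-diff)
  open import Algebra.Apartness.Properties.HeytingCommutativeRing heytingCommutativeRing
    using (#-congʳ; 1#0; invertibleˡ⇒#; x#0y#0→xy#0)
  open IntegerCoefficients commutativeRing using (module Solver)
  open Solver
  open import Relation.Binary.Reasoning.Setoid setoid

  module < = IsStrictPartialOrder isStrictPartialOrder

  recip-diff-inverse : ∀ {x y} (x#y : x # y) → (x - y) * recip-diff x#y ≈ 1#
  recip-diff-inverse x#y = proj₂ (proj₂ (#⇒invertible x#y))

  #0⇒unit : ∀ {x} → x # 0# → ∃ λ y → x * y ≈ 1#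
  #0⇒unit {x} x#0 with y , _ , xy≈1 ← #⇒invertible x#0 =
    y , trans (solve 2 (λ x y → x :* y := (x :- con (pos 0)) :* y) refl x y) xy≈1

  unit⇒# : ∀ {x y} z → (x - y) * z ≈ 1# → x # y
  unit⇒# z eq = invertibleˡ⇒# (z , trans (*-comm _ _) eq)

  unit⇒#0 : ∀ {x} z → x * z ≈ 1# → x # 0#
  unit⇒#0 {x} z eq =
    unit⇒# z (trans (solve 2 (λ x z → (x :- con (pos 0)) :* z := x :* z) refl x z) eq)

  unit-cancelˡ : ∀ {a b} x y → a * b ≈ 1# → a * x ≈ a * y → x ≈ y
  unit-cancelˡ {a} {b} x y ab≈1 ax≈ay = begin
    x            ≈⟨ trans (*-congʳ ab≈1) (*-identityˡ x) ⟨
    a * b * x    ≈⟨ solve 3 (λ a b x → a :* b :* x := b :* (a :* x)) refl a b x ⟩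
    b * (a * x)  ≈⟨ *-congˡ ax≈ay ⟩
    b * (a * y)  ≈⟨ solve 3 (λ a b x → a :* b :* x := b :* (a :* x)) refl a b y ⟨
    a * b * y    ≈⟨ trans (*-congʳ ab≈1) (*-identityˡ y) ⟩
    y            ∎

  -- Cotransitivity compares x with both ends of x + y # 0. Either x # 0 at once, or x + y # x, and
  -- then the invertible difference of these two is y.
  +-#0 : ∀ {x y} → x + y # 0# → x # 0# ⊎ y # 0#
  +-#0 {x} {y} x+y#0 with #-cotrans x+y#0 x
  ... | inj₂ x#0   = inj₁ x#0
  ... | inj₁ x+y#x with z , eq , _ ← #⇒invertible x+y#x =
    inj₂ (unit⇒#0 z (trans (solve 3 (λ x y z → y :* z := z :* (x :+ y :- x)) refl x y z) eq))

  -- Each use of `+-#0` either stops at the head or passes on to the tail, which produces an index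
  -- without testing any entry.
  sum-#0 : ∀ {n} (f : Vector Carrier n) → sum f # 0# → ∃ λ i → f i # 0#
  sum-#0 {zero}  f 0#0 = ⊥-elim (#-irrefl refl 0#0)
  sum-#0 {suc n} f s#0 with +-#0 s#0
  ... | inj₁ f₀#0 = zero , f₀#0
  ... | inj₂ r#0 with i , fᵢ#0 ← sum-#0 (λ i → f (suc i)) r#0 = suc i , fᵢ#0

  <⇒# : ∀ {x y} → x < y → x # y
  <⇒# x<y = Equivalence.from (#⇔<⊎> _ _) (inj₁ x<y)

  0<⇒#0 : ∀ {x} → 0# < x → x # 0#
  0<⇒#0 0<x = #-sym (<⇒# 0<x)

  -- Cotransitivity of apartness separates z from one of the ends, and the order tells on which
  -- side. If z falls outside the interval, transitivity supplies the comparison with the other end.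
  <-cotrans : ∀ {x y} → x < y → ∀ z → x < z ⊎ z < y
  <-cotrans x<y z with #-cotrans (<⇒# x<y) z
  ... | inj₁ x#z with Equivalence.to (#⇔<⊎> _ _) x#z
  ...   | inj₁ x<z = inj₁ x<z
  ...   | inj₂ z<x = inj₂ (<.trans z<x x<y)
  <-cotrans x<y z | inj₂ z#y with Equivalence.to (#⇔<⊎> _ _) z#y
  ...   | inj₁ z<y = inj₂ z<y
  ...   | inj₂ y<z = inj₁ (<.trans x<y y<z)

  -- Inserting a + b into 0 < a leaves only a + b < a to refute, and subtracting a there would make
  -- b negative.
  pos+nonneg : ∀ {a b} → 0# < a → ¬ (b < 0#) → 0# < a + b
  pos+nonneg {a} {b} 0<a b≮0 with <-cotrans 0<a (a + b)
  ... | inj₁ 0<a+b = 0<a+b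
  ... | inj₂ a+b<a = ⊥-elim (b≮0 (<.<-respˡ-≈ (solve 2 (λ a b → a :+ b :- a := b) refl a b)
                          (<.<-respʳ-≈ (-‿inverseʳ a) (+-monoˡ-< (- a) a+b<a))))

  nonneg+pos : ∀ {a b} → ¬ (a < 0#) → 0# < b → 0# < a + b
  nonneg+pos a≮0 0<b = <.<-respʳ-≈ (+-comm _ _) (pos+nonneg 0<b a≮0)

  nonneg+nonneg : ∀ {a b} → ¬ (a < 0#) → ¬ (b < 0#) → ¬ (a + b < 0#)
  nonneg+nonneg {a} {b} a≮0 b≮0 a+b<0 with <-cotrans a+b<0 a
  ... | inj₂ a<0 = a≮0 a<0
  ... | inj₁ a+b<a = b≮0 (<.<-respˡ-≈ (solve 2 (λ a b → a :+ b :- a := b) refl a b)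
                          (<.<-respʳ-≈ (-‿inverseʳ a) (+-monoˡ-< (- a) a+b<a)))

  neg-pos : ∀ {x} → x < 0# → 0# < - x
  neg-pos {x} x<0 = <.<-respˡ-≈ (-‿inverseʳ x) (<.<-respʳ-≈ (+-identityˡ (- x)) (+-monoˡ-< (- x) x<0))

  square-pos : ∀ {x} → x # 0# → 0# < x * x
  square-pos {x} x#0 with Equivalence.to (#⇔<⊎> _ _) x#0
  ... | inj₂ 0<x = *-pos 0<x 0<x
  ... | inj₁ x<0 = <.<-respʳ-≈ (solve 1 (λ x → (:- x) :* (:- x) := x :* x) refl x)
                     (*-pos (neg-pos x<0) (neg-pos x<0))

  -- The sign of x cannot be decided, but x * x < 0 makes x * x invertible, hence x invertible and
  -- apart from 0, and then its square is positive.
  square-nonneg : ∀ x → ¬ (x * x < 0#)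
  square-nonneg x x²<0 with z , eq ← #0⇒unit (<⇒# x²<0) =
    <.asym x²<0 (square-pos (unit⇒#0 (x * z) (trans (sym (*-assoc x x z)) eq)))

  sum-nonneg : ∀ {n} {f : Vector Carrier n} → (∀ i → ¬ (f i < 0#)) → ¬ (sum f < 0#)
  sum-nonneg {zero}  f≮0 = <.irrefl refl
  sum-nonneg {suc n} f≮0 = nonneg+nonneg (f≮0 zero) (sum-nonneg (λ i → f≮0 (suc i)))

  sum-pos : ∀ {n} {f : Vector Carrier n} → (∀ i → ¬ (f i < 0#)) → ∀ i → 0# < f i → 0# < sum f
  sum-pos f≮0 zero    0<f = pos+nonneg 0<f (sum-nonneg (λ i → f≮0 (suc i)))
  sum-pos f≮0 (suc i) 0<f = nonneg+pos (f≮0 zero) (sum-pos (λ i → f≮0 (suc i)) i 0<f)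

  0<1 : 0# < 1#
  0<1 = <.<-respʳ-≈ (*-identityˡ 1#) (square-pos 1#0)

  fromℕ-nonneg : ∀ n → ¬ (fromℕ n < 0#)
  fromℕ-nonneg zero    = <.irrefl refl
  fromℕ-nonneg (suc n) = nonneg+nonneg (<.asym 0<1) (fromℕ-nonneg n)

  fromℕ-pos : ∀ n → 0# < fromℕ (suc n)
  fromℕ-pos n = pos+nonneg 0<1 (fromℕ-nonneg n)

  fromℕ-unit : ∀ n → .{{NonZero n}} → ∃ λ y → fromℕ n * y ≈ 1#
  fromℕ-unit (suc n) = #0⇒unit (0<⇒#0 (fromℕ-pos n))

  double≈ : ∀ x → fromℕ 2 * x ≈ x + x
  double≈ = solve 1 (λ x → (con (pos 1) :+ (con (pos 1) :+ con (pos 0))) :* x := x :+ x) refl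

  -- The order forces 2 to be invertible. This undoes the double counting when unordered pairs are
  -- summed as ordered ones.
  double-cancel : ∀ {x y} → x + x ≈ y + y → x ≈ y
  double-cancel {x} {y} eq =
    unit-cancelˡ x y (proj₂ (fromℕ-unit 2)) (trans (double≈ x) (trans eq (sym (double≈ y))))

  +-double-#0 : ∀ {x} → x # 0# → x + x # 0#
  +-double-#0 {x} x#0 = #-congʳ (double≈ x) (x#0y#0→xy#0 (0<⇒#0 (fromℕ-pos 1)) x#0)

  half-pos : ∀ {x} → 0# < x + x → 0# < x
  half-pos {x} 0<2x with <-cotrans 0<2x x
  ... | inj₁ 0<x  = 0<x
  ... | inj₂ x<2x = <.<-respˡ-≈ (-‿inverseʳ x) (<.<-respʳ-≈ (solve 1 (λ x → x :+ x :- x := x) refl x) (+-monoˡ-< (- x) x<2x))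

-- Matrix algebra, complementary inverses and uniqueness of the Moore-Penrose inverse.

module Matrices {c ℓ₁ ℓ₂ ℓ₃} (K : OrderedField c ℓ₁ ℓ₂ ℓ₃) where

  open OrderedField K hiding (zero; Carrier; _≈_; _#_; _+_; _*_; -_; _-_; 0#; 1#; #⇒invertible)
  open Over K
  open CommutativeRing commutativeRing using (semiring)
  open import Algebra.Properties.Semiring.Sum semiring
    using (sum-cong-≋; ∑-distrib-+; ∑-comm; *-distribˡ-sum; *-distribʳ-sum; sum-replicate-zero)
  open IntegerCoefficients commutativeRing using (module Solver)
  open Solver

  module ≈-Reasoning = Relation.Binary.Reasoning.Setoid setoid

  sum-zero : {f : Vector Carrier n} → (∀ i → f i ≈ 0#) → sum f ≈ 0#
  sum-zero {n} f≈0 = trans (sum-cong-≋ f≈0) (sum-replicate-zero n)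

  weighted-sum-zero : (w : Vector Carrier n) {f : Vector Carrier n} → (∀ i → f i ≈ 0#) → sum (λ i → w i * f i) ≈ 0#
  weighted-sum-zero w f≈0 = sum-zero (λ i → trans (*-congˡ {x = w i} (f≈0 i)) (zeroʳ (w i)))

  sum-distrib-- : (f g : Vector Carrier n) → sum (λ i → f i - g i) ≈ sum f - sum g
  sum-distrib-- {zero}  f g = sym (-‿inverseʳ 0#)
  sum-distrib-- {suc n} f g = trans (+-congˡ (sum-distrib-- (λ i → f (suc i)) (λ i → g (suc i))))
    (solve 4 (λ a b c d → a :- b :+ (c :- d) := a :+ c :- (b :+ d)) refl _ _ _ _)

  sum-single : (f : Vector Carrier n) (i : Fin n) → (∀ j → j ≢ i → f j ≈ 0#) → sum f ≈ f i
  sum-single f zero    f≈0 = trans (+-congˡ (sum-zero (λ j → f≈0 (suc j) λ ()))) (+-identityʳ _)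
  sum-single f (suc i) f≈0 = trans (+-cong (f≈0 zero λ ())
    (sum-single (λ j → f (suc j)) i (λ j j≢i → f≈0 (suc j) (λ eq → j≢i (suc-injective eq))))) (+-identityˡ _)

  basis-≡ : (i : Fin n) → basis i i ≈ 1#
  basis-≡ i with i ≟ i
  ... | yes _  = refl
  ... | no i≢i = ⊥-elim (i≢i ≡.refl)

  basis-≢ : {i j : Fin n} → i ≢ j → basis i j ≈ 0#
  basis-≢ {i = i} {j} i≢j with i ≟ j
  ... | yes i≡j = ⊥-elim (i≢j i≡j)
  ... | no _    = refl

  basis-sym : (i j : Fin n) → basis i j ≈ basis j i
  basis-sym zero    zero    = refl
  basis-sym zero    (suc j) = refl
  basis-sym (suc i) zero    = refl
  basis-sym (suc i) (suc j) = basis-sym i j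

  sum-basis : (i : Fin n) (f : Vector Carrier n) → sum (λ j → basis i j * f j) ≈ f i
  sum-basis i f = trans
    (sum-single (λ j → basis i j * f j) i (λ j j≢i → trans (*-congʳ (basis-≢ (λ i≡j → j≢i (≡.sym i≡j)))) (zeroˡ _)))
    (trans (*-congʳ (basis-≡ i)) (*-identityˡ _))

  sum-basis-one : (i : Fin n) → sum (basis i) ≈ 1#
  sum-basis-one i = trans (sum-cong-≋ (λ j → sym (*-identityʳ (basis i j)))) (sum-basis i (λ _ → 1#))

  infixl 6 _+ᴹ_
  _+ᴹ_ : Matrix m n → Matrix m n → Matrix m n
  (A +ᴹ B) i j = A i j + B i j

  ones : Matrix m n
  ones _ _ = 1#

  matrixSetoid : ℕ → ℕ → Setoid c ℓ₁
  matrixSetoid m n = record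
    { Carrier = Matrix m n
    ; _≈_ = _≈ᴹ_
    ; isEquivalence = record
      { refl  = λ _ _ → refl
      ; sym   = λ A≈B i j → sym (A≈B i j)
      ; trans = λ A≈B B≈C i j → trans (A≈B i j) (B≈C i j)
      }
    }

  module ≈ᴹ {m n : ℕ} where
    open Setoid (matrixSetoid m n) public using (refl; sym; trans)
  module ≈ᴹ-Reasoning {m n : ℕ} = Relation.Binary.Reasoning.Setoid (matrixSetoid m n)

  transpose-cong : {A B : Matrix m n} → A ≈ᴹ B → transpose A ≈ᴹ transpose B
  transpose-cong A≈B i j = A≈B j i

  +ᴹ-cong : {A A′ B B′ : Matrix m n} → A ≈ᴹ A′ → B ≈ᴹ B′ → A +ᴹ B ≈ᴹ A′ +ᴹ B′
  +ᴹ-cong A≈A′ B≈B′ i j = +-cong (A≈A′ i j) (B≈B′ i j)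

  -ᴹ-cong : {A A′ B B′ : Matrix m n} → A ≈ᴹ A′ → B ≈ᴹ B′ → A -ᴹ B ≈ᴹ A′ -ᴹ B′
  -ᴹ-cong A≈A′ B≈B′ i j = +-cong (A≈A′ i j) (-‿cong (B≈B′ i j))

  ·ᴹ-cong : ∀ a {A B : Matrix m n} → A ≈ᴹ B → a ·ᴹ A ≈ᴹ a ·ᴹ B
  ·ᴹ-cong a A≈B i j = *-congˡ (A≈B i j)

  *ᴹ-cong : {A A′ : Matrix l m} {B B′ : Matrix m n} → A ≈ᴹ A′ → B ≈ᴹ B′ → A *ᴹ B ≈ᴹ A′ *ᴹ B′
  *ᴹ-cong A≈A′ B≈B′ i k = sum-cong-≋ (λ j → *-cong (A≈A′ i j) (B≈B′ j k))

  *ᴹ-congˡ : (A : Matrix l m) {B B′ : Matrix m n} → B ≈ᴹ B′ → A *ᴹ B ≈ᴹ A *ᴹ B′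
  *ᴹ-congˡ A = *ᴹ-cong {A = A} ≈ᴹ.refl

  *ᴹ-congʳ : {A A′ : Matrix l m} (B : Matrix m n) → A ≈ᴹ A′ → A *ᴹ B ≈ᴹ A′ *ᴹ B
  *ᴹ-congʳ B A≈A′ = *ᴹ-cong {B = B} A≈A′ ≈ᴹ.refl

  *ᴹ-assoc : (A : Matrix k l) (B : Matrix l m) (C : Matrix m n) → A *ᴹ B *ᴹ C ≈ᴹ A *ᴹ (B *ᴹ C)
  *ᴹ-assoc {l = l} {m} A B C i j = begin
    sum (λ q → sum (λ p → A i p * B p q) * C q j)    ≈⟨ sum-cong-≋ (λ q → *-distribʳ-sum (C q j) (λ p → A i p * B p q)) ⟩
    sum (λ q → sum (λ p → A i p * B p q * C q j))    ≈⟨ ∑-comm {m} {l} (λ q p → A i p * B p q * C q j) ⟩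
    sum (λ p → sum (λ q → A i p * B p q * C q j))    ≈⟨ sum-cong-≋ (λ p → sum-cong-≋ (λ q → *-assoc (A i p) (B p q) (C q j))) ⟩
    sum (λ p → sum (λ q → A i p * (B p q * C q j)))  ≈⟨ sum-cong-≋ (λ p → *-distribˡ-sum (A i p) (λ q → B p q * C q j)) ⟨
    sum (λ p → A i p * sum (λ q → B p q * C q j))    ∎
    where open ≈-Reasoning

  *ᴹ-identityˡ : (A : Matrix m n) → 1ᴹ *ᴹ A ≈ᴹ A
  *ᴹ-identityˡ A i j = sum-basis i (λ k → A k j)

  *ᴹ-identityʳ : (A : Matrix m n) → A *ᴹ 1ᴹ ≈ᴹ A
  *ᴹ-identityʳ A i j = trans
    (sum-cong-≋ (λ k → trans (*-comm (A i k) (basis k j)) (*-congʳ (basis-sym k j)))) (sum-basis j (A i))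

  *ᴹ-distribˡ-+ᴹ : (A : Matrix l m) (B C : Matrix m n) → A *ᴹ (B +ᴹ C) ≈ᴹ A *ᴹ B +ᴹ A *ᴹ C
  *ᴹ-distribˡ-+ᴹ A B C i j = trans (sum-cong-≋ (λ k → distribˡ (A i k) (B k j) (C k j)))
    (∑-distrib-+ (λ k → A i k * B k j) (λ k → A i k * C k j))

  *ᴹ-distribʳ-+ᴹ : (A : Matrix m n) (B C : Matrix l m) → (B +ᴹ C) *ᴹ A ≈ᴹ B *ᴹ A +ᴹ C *ᴹ A
  *ᴹ-distribʳ-+ᴹ A B C i j = trans (sum-cong-≋ (λ k → distribʳ (A k j) (B i k) (C i k)))
    (∑-distrib-+ (λ k → B i k * A k j) (λ k → C i k * A k j))

  *ᴹ-distribˡ--ᴹ : (A : Matrix l m) (B C : Matrix m n) → A *ᴹ (B -ᴹ C) ≈ᴹ A *ᴹ B -ᴹ A *ᴹ C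
  *ᴹ-distribˡ--ᴹ A B C i j = trans
    (sum-cong-≋ (λ k → solve 3 (λ a b c → a :* (b :- c) := a :* b :- a :* c) refl (A i k) (B k j) (C k j)))
    (sum-distrib-- (λ k → A i k * B k j) (λ k → A i k * C k j))

  *ᴹ-distribʳ--ᴹ : (A : Matrix m n) (B C : Matrix l m) → (B -ᴹ C) *ᴹ A ≈ᴹ B *ᴹ A -ᴹ C *ᴹ A
  *ᴹ-distribʳ--ᴹ A B C i j = trans
    (sum-cong-≋ (λ k → solve 3 (λ a b c → (b :- c) :* a := b :* a :- c :* a) refl (A k j) (B i k) (C i k)))
    (sum-distrib-- (λ k → B i k * A k j) (λ k → C i k * A k j))

  ·ᴹ-*ᴹ : ∀ a (A : Matrix l m) (B : Matrix m n) → (a ·ᴹ A) *ᴹ B ≈ᴹ a ·ᴹ (A *ᴹ B)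
  ·ᴹ-*ᴹ a A B i j = trans (sum-cong-≋ (λ k → *-assoc a (A i k) (B k j)))
    (sym (*-distribˡ-sum a (λ k → A i k * B k j)))

  *ᴹ-·ᴹ : ∀ a (A : Matrix l m) (B : Matrix m n) → A *ᴹ (a ·ᴹ B) ≈ᴹ a ·ᴹ (A *ᴹ B)
  *ᴹ-·ᴹ a A B i j = trans
    (sum-cong-≋ (λ k → solve 3 (λ x a b → x :* (a :* b) := a :* (x :* b)) refl (A i k) a (B k j)))
    (sym (*-distribˡ-sum a (λ k → A i k * B k j)))

  transpose-*ᴹ : (A : Matrix l m) (B : Matrix m n) → transpose (A *ᴹ B) ≈ᴹ transpose B *ᴹ transpose A
  transpose-*ᴹ A B i j = sum-cong-≋ (λ k → *-comm (A j k) (B k i))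

  tr-cong : {A B : Matrix n n} → A ≈ᴹ B → tr A ≈ tr B
  tr-cong A≈B = sum-cong-≋ (λ i → A≈B i i)

  tr-+ᴹ : (A B : Matrix n n) → tr (A +ᴹ B) ≈ tr A + tr B
  tr-+ᴹ A B = ∑-distrib-+ (λ i → A i i) (λ i → B i i)

  tr--ᴹ : (A B : Matrix n n) → tr (A -ᴹ B) ≈ tr A - tr B
  tr--ᴹ A B = sum-distrib-- (λ i → A i i) (λ i → B i i)

  tr-·ᴹ : ∀ a (A : Matrix n n) → tr (a ·ᴹ A) ≈ a * tr A
  tr-·ᴹ a A = sym (*-distribˡ-sum a (λ i → A i i))

  sum-ones : ∀ n → sum {n} (λ _ → 1#) ≈ fromℕ n
  sum-ones zero    = refl
  sum-ones (suc n) = +-congˡ (sum-ones n)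

  tr-1ᴹ : ∀ n → tr (1ᴹ {n}) ≈ fromℕ n
  tr-1ᴹ n = trans (sum-cong-≋ {n} basis-≡) (sum-ones n)

  tr-*ᴹ-comm : (A : Matrix m n) (B : Matrix n m) → tr (A *ᴹ B) ≈ tr (B *ᴹ A)
  tr-*ᴹ-comm {m} {n} A B = trans (∑-comm {m} {n} (λ i j → A i j * B j i))
    (sum-cong-≋ (λ j → sum-cong-≋ (λ i → *-comm (A i j) (B j i))))

  -- The condition inside `Invertibleᴹ`, with the inverse as a parameter: its closed form must stay
  -- visible for the trace computation.
  IsInverseᴹ : Matrix n n → Matrix n n → Set ℓ₁
  IsInverseᴹ A A⁻¹ = (A⁻¹ *ᴹ A ≈ᴹ 1ᴹ) × (A *ᴹ A⁻¹ ≈ᴹ 1ᴹ)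

  -- The identity (a - BA) (1 + B P A) = a - BA + B (a - AB) P A, and its mirror image.
  complementary-inverse : ∀ {a a⁻¹} → a * a⁻¹ ≈ 1# → (A : Matrix m n) (B : Matrix n m) →
    ((P , _) : Invertibleᴹ (a ·ᴹ 1ᴹ -ᴹ A *ᴹ B)) →
    IsInverseᴹ (a ·ᴹ 1ᴹ -ᴹ B *ᴹ A) (a⁻¹ ·ᴹ (1ᴹ +ᴹ B *ᴹ P *ᴹ A))
  complementary-inverse {m} {n} {a} {a⁻¹} aa⁻¹≈1 A B (P , PN≈1 , NP≈1) = left , right
    where
    N : Matrix m m
    N = a ·ᴹ 1ᴹ -ᴹ A *ᴹ B
    M Y : Matrix n n
    M = a ·ᴹ 1ᴹ -ᴹ B *ᴹ A
    Y = B *ᴹ P *ᴹ A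

    scaled-1-* : ∀ {p q} (X : Matrix p q) → (a ·ᴹ 1ᴹ) *ᴹ X ≈ᴹ a ·ᴹ X
    scaled-1-* X = ≈ᴹ.trans (·ᴹ-*ᴹ a 1ᴹ X) (·ᴹ-cong a (*ᴹ-identityˡ X))
    *-scaled-1 : ∀ {p q} (X : Matrix p q) → X *ᴹ (a ·ᴹ 1ᴹ) ≈ᴹ a ·ᴹ X
    *-scaled-1 X = ≈ᴹ.trans (*ᴹ-·ᴹ a X 1ᴹ) (·ᴹ-cong a (*ᴹ-identityʳ X))

    -- Both sides expand to a B - B A B. This carries M across B, where it becomes N and meets its
    -- inverse P; `AM≈NA` does the same from the other side.
    MB≈BN : M *ᴹ B ≈ᴹ B *ᴹ N
    MB≈BN = begin
      M *ᴹ B                                    ≈⟨ *ᴹ-distribʳ--ᴹ B (a ·ᴹ 1ᴹ) (B *ᴹ A) ⟩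
      (a ·ᴹ 1ᴹ) *ᴹ B -ᴹ B *ᴹ A *ᴹ B            ≈⟨ -ᴹ-cong (scaled-1-* B) (*ᴹ-assoc B A B) ⟩
      a ·ᴹ B -ᴹ B *ᴹ (A *ᴹ B)                  ≈⟨ -ᴹ-cong (*-scaled-1 B) ≈ᴹ.refl ⟨
      B *ᴹ (a ·ᴹ 1ᴹ) -ᴹ B *ᴹ (A *ᴹ B)          ≈⟨ *ᴹ-distribˡ--ᴹ B (a ·ᴹ 1ᴹ) (A *ᴹ B) ⟨
      B *ᴹ N                                    ∎
      where open ≈ᴹ-Reasoning
    AM≈NA : A *ᴹ M ≈ᴹ N *ᴹ A
    AM≈NA = begin
      A *ᴹ M                                    ≈⟨ *ᴹ-distribˡ--ᴹ A (a ·ᴹ 1ᴹ) (B *ᴹ A) ⟩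
      A *ᴹ (a ·ᴹ 1ᴹ) -ᴹ A *ᴹ (B *ᴹ A)          ≈⟨ -ᴹ-cong (*-scaled-1 A) (≈ᴹ.sym (*ᴹ-assoc A B A)) ⟩
      a ·ᴹ A -ᴹ A *ᴹ B *ᴹ A                    ≈⟨ -ᴹ-cong (scaled-1-* A) ≈ᴹ.refl ⟨
      (a ·ᴹ 1ᴹ) *ᴹ A -ᴹ A *ᴹ B *ᴹ A            ≈⟨ *ᴹ-distribʳ--ᴹ A (a ·ᴹ 1ᴹ) (A *ᴹ B) ⟨
      N *ᴹ A                                    ∎
      where open ≈ᴹ-Reasoning

    MY≈BA : M *ᴹ Y ≈ᴹ B *ᴹ A
    MY≈BA = begin
      M *ᴹ (B *ᴹ P *ᴹ A)   ≈⟨ *ᴹ-assoc M (B *ᴹ P) A ⟨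
      M *ᴹ (B *ᴹ P) *ᴹ A   ≈⟨ *ᴹ-congʳ A (*ᴹ-assoc M B P) ⟨
      M *ᴹ B *ᴹ P *ᴹ A     ≈⟨ *ᴹ-congʳ A (*ᴹ-congʳ P MB≈BN) ⟩
      B *ᴹ N *ᴹ P *ᴹ A     ≈⟨ *ᴹ-congʳ A (*ᴹ-assoc B N P) ⟩
      B *ᴹ (N *ᴹ P) *ᴹ A   ≈⟨ *ᴹ-congʳ A (*ᴹ-congˡ B NP≈1) ⟩
      B *ᴹ 1ᴹ *ᴹ A         ≈⟨ *ᴹ-congʳ A (*ᴹ-identityʳ B) ⟩
      B *ᴹ A               ∎
      where open ≈ᴹ-Reasoning
    YM≈BA : Y *ᴹ M ≈ᴹ B *ᴹ A
    YM≈BA = begin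
      B *ᴹ P *ᴹ A *ᴹ M     ≈⟨ *ᴹ-assoc (B *ᴹ P) A M ⟩
      B *ᴹ P *ᴹ (A *ᴹ M)   ≈⟨ *ᴹ-congˡ (B *ᴹ P) AM≈NA ⟩
      B *ᴹ P *ᴹ (N *ᴹ A)   ≈⟨ *ᴹ-assoc (B *ᴹ P) N A ⟨
      B *ᴹ P *ᴹ N *ᴹ A     ≈⟨ *ᴹ-congʳ A (*ᴹ-assoc B P N) ⟩
      B *ᴹ (P *ᴹ N) *ᴹ A   ≈⟨ *ᴹ-congʳ A (*ᴹ-congˡ B PN≈1) ⟩
      B *ᴹ 1ᴹ *ᴹ A         ≈⟨ *ᴹ-congʳ A (*ᴹ-identityʳ B) ⟩
      B *ᴹ A               ∎
      where open ≈ᴹ-Reasoning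

    rescale : a⁻¹ ·ᴹ (M +ᴹ B *ᴹ A) ≈ᴹ 1ᴹ
    rescale i j = begin
      a⁻¹ * (a * 1ᴹ i j - (B *ᴹ A) i j + (B *ᴹ A) i j)
        ≈⟨ solve 4 (λ a⁻¹ a x y → a⁻¹ :* (a :* x :- y :+ y) := a :* a⁻¹ :* x) refl a⁻¹ a (1ᴹ i j) ((B *ᴹ A) i j) ⟩
      a * a⁻¹ * 1ᴹ i j  ≈⟨ *-congʳ aa⁻¹≈1 ⟩
      1# * 1ᴹ i j       ≈⟨ *-identityˡ _ ⟩
      1ᴹ i j            ∎
      where open ≈-Reasoning

    left : (a⁻¹ ·ᴹ (1ᴹ +ᴹ Y)) *ᴹ M ≈ᴹ 1ᴹ
    left = begin
      (a⁻¹ ·ᴹ (1ᴹ +ᴹ Y)) *ᴹ M       ≈⟨ ·ᴹ-*ᴹ a⁻¹ (1ᴹ +ᴹ Y) M ⟩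
      a⁻¹ ·ᴹ ((1ᴹ +ᴹ Y) *ᴹ M)       ≈⟨ ·ᴹ-cong a⁻¹ (*ᴹ-distribʳ-+ᴹ M 1ᴹ Y) ⟩
      a⁻¹ ·ᴹ (1ᴹ *ᴹ M +ᴹ Y *ᴹ M)    ≈⟨ ·ᴹ-cong a⁻¹ (+ᴹ-cong (*ᴹ-identityˡ M) YM≈BA) ⟩
      a⁻¹ ·ᴹ (M +ᴹ B *ᴹ A)          ≈⟨ rescale ⟩
      1ᴹ                             ∎
      where open ≈ᴹ-Reasoning
    right : M *ᴹ (a⁻¹ ·ᴹ (1ᴹ +ᴹ Y)) ≈ᴹ 1ᴹ
    right = begin
      M *ᴹ (a⁻¹ ·ᴹ (1ᴹ +ᴹ Y))       ≈⟨ *ᴹ-·ᴹ a⁻¹ M (1ᴹ +ᴹ Y) ⟩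
      a⁻¹ ·ᴹ (M *ᴹ (1ᴹ +ᴹ Y))       ≈⟨ ·ᴹ-cong a⁻¹ (*ᴹ-distribˡ-+ᴹ M 1ᴹ Y) ⟩
      a⁻¹ ·ᴹ (M *ᴹ 1ᴹ +ᴹ M *ᴹ Y)    ≈⟨ ·ᴹ-cong a⁻¹ (+ᴹ-cong (*ᴹ-identityʳ M) MY≈BA) ⟩
      a⁻¹ ·ᴹ (M +ᴹ B *ᴹ A)          ≈⟨ rescale ⟩
      1ᴹ                             ∎
      where open ≈ᴹ-Reasoning

  -- Penrose's argument: AX = (AY)(AX), and transposing this product of symmetric matrices gives
  -- (AX)(AY) = AY. Likewise XA = YA, so X = XAX = XAY = YAY = Y.
  moorePenrose-unique : {A : Matrix m n} (X Y : MoorePenroseInverse A) →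
    MoorePenroseInverse.A⁺ X ≈ᴹ MoorePenroseInverse.A⁺ Y
  moorePenrose-unique {A = A} XI YI = begin
    X                  ≈⟨ X.A⁺AA⁺≈A⁺ ⟨
    X *ᴹ A *ᴹ X        ≈⟨ *ᴹ-assoc X A X ⟩
    X *ᴹ (A *ᴹ X)      ≈⟨ *ᴹ-congˡ X AX≈AY ⟩
    X *ᴹ (A *ᴹ Y)      ≈⟨ *ᴹ-assoc X A Y ⟨
    X *ᴹ A *ᴹ Y        ≈⟨ *ᴹ-congʳ Y XA≈YA ⟩
    Y *ᴹ A *ᴹ Y        ≈⟨ Y.A⁺AA⁺≈A⁺ ⟩
    Y                  ∎
    where
    module X = MoorePenroseInverse XI
    module Y = MoorePenroseInverse YI
    X = X.A⁺
    Y = Y.A⁺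
    open ≈ᴹ-Reasoning
    AX≈AY : A *ᴹ X ≈ᴹ A *ᴹ Y
    AX≈AY = begin
      A *ᴹ X                                     ≈⟨ X.AA⁺-symm ⟨
      transpose (A *ᴹ X)                         ≈⟨ transpose-cong (*ᴹ-congʳ X Y.AA⁺A≈A) ⟨
      transpose (A *ᴹ Y *ᴹ A *ᴹ X)               ≈⟨ transpose-cong (*ᴹ-assoc (A *ᴹ Y) A X) ⟩
      transpose (A *ᴹ Y *ᴹ (A *ᴹ X))             ≈⟨ transpose-*ᴹ (A *ᴹ Y) (A *ᴹ X) ⟩
      transpose (A *ᴹ X) *ᴹ transpose (A *ᴹ Y)   ≈⟨ *ᴹ-cong X.AA⁺-symm Y.AA⁺-symm ⟩
      A *ᴹ X *ᴹ (A *ᴹ Y)                         ≈⟨ *ᴹ-assoc (A *ᴹ X) A Y ⟨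
      A *ᴹ X *ᴹ A *ᴹ Y                           ≈⟨ *ᴹ-congʳ Y X.AA⁺A≈A ⟩
      A *ᴹ Y                                     ∎
    XA≈YA : X *ᴹ A ≈ᴹ Y *ᴹ A
    XA≈YA = begin
      X *ᴹ A                                     ≈⟨ X.A⁺A-symm ⟨
      transpose (X *ᴹ A)                         ≈⟨ transpose-cong (*ᴹ-congˡ X Y.AA⁺A≈A) ⟨
      transpose (X *ᴹ (A *ᴹ Y *ᴹ A))             ≈⟨ transpose-cong (*ᴹ-congˡ X (*ᴹ-assoc A Y A)) ⟩
      transpose (X *ᴹ (A *ᴹ (Y *ᴹ A)))           ≈⟨ transpose-cong (*ᴹ-assoc X A (Y *ᴹ A)) ⟨
      transpose (X *ᴹ A *ᴹ (Y *ᴹ A))             ≈⟨ transpose-*ᴹ (X *ᴹ A) (Y *ᴹ A) ⟩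
      transpose (Y *ᴹ A) *ᴹ transpose (X *ᴹ A)   ≈⟨ *ᴹ-cong Y.A⁺A-symm X.A⁺A-symm ⟩
      Y *ᴹ A *ᴹ (X *ᴹ A)                         ≈⟨ *ᴹ-assoc Y A (X *ᴹ A) ⟩
      Y *ᴹ (A *ᴹ (X *ᴹ A))                       ≈⟨ *ᴹ-congˡ Y (*ᴹ-assoc A X A) ⟨
      Y *ᴹ (A *ᴹ X *ᴹ A)                         ≈⟨ *ᴹ-congˡ Y X.AA⁺A≈A ⟩
      Y *ᴹ A                                     ∎

-- Alternating multilinear functions and multiplicativity of the determinant.

module Determinants {c ℓ₁ ℓ₂ ℓ₃} (K : OrderedField c ℓ₁ ℓ₂ ℓ₃) where

  open OrderedField K hiding (zero; Carrier; _≈_; _#_; _+_; _*_; -_; _-_; 0#; 1#; #⇒invertible)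
  open Over K
  open Matrices K
  open CommutativeRing commutativeRing using (semiring)
  open import Algebra.Properties.Semiring.Sum semiring
    using (sum-cong-≋; ∑-distrib-+; *-distribˡ-sum; *-distribʳ-sum)
  open IntegerCoefficients commutativeRing using (module Solver)
  open Solver
  open Vector using (_∷_; head; tail; removeAt)
  open ≈-Reasoning

  Congruent : (Matrix n m → Carrier) → Set _
  Congruent f = ∀ {A B} → A ≈ᴹ B → f A ≈ f B

  -- One equation covers additivity (x = 1) and homogeneity (b = 0): the case x = 1, a = b = 0
  -- already forces the value 0 at the zero vector.
  HeadLinear : (Matrix (suc n) m → Carrier) → Set _
  HeadLinear f = ∀ x a b A → f ((λ i → x * a i + b i) ∷ A) ≈ x * f (a ∷ A) + f (b ∷ A)

  RepeatedHeadVanishes : ∀ n → (Matrix (suc n) m → Carrier) → Set (c ⊔ ℓ₁)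
  RepeatedHeadVanishes zero    f = Lift _ ⊤
  RepeatedHeadVanishes (suc n) f = ∀ a A → f (a ∷ a ∷ A) ≈ 0#

  -- Alternating multilinear functions of n vectors, one argument at a time: equal
  -- neighbours in any position become equal leading arguments of a partial
  -- application.
  Alternating : ∀ n → (Matrix n m → Carrier) → Set (c ⊔ ℓ₁)
  Alternating zero    f = Congruent f
  Alternating (suc n) f =
    Congruent f × HeadLinear f × RepeatedHeadVanishes n f × (∀ a → Alternating n (λ A → f (a ∷ A)))

  alternating⇒congruent : ∀ n {f : Matrix n m → Carrier} → Alternating n f → Congruent f
  alternating⇒congruent zero    f-cong       = f-cong
  alternating⇒congruent (suc n) (f-cong , _) = f-cong

  ∷-congˡ : ∀ a {A B : Matrix n m} → A ≈ᴹ B → a ∷ A ≈ᴹ a ∷ B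
  ∷-congˡ a A≈B zero    j = refl
  ∷-congˡ a A≈B (suc i) j = A≈B i j

  ∷-congʳ : ∀ {a b} (A : Matrix n m) → (∀ j → a j ≈ b j) → a ∷ A ≈ᴹ b ∷ A
  ∷-congʳ A a≈b zero    j = a≈b j
  ∷-congʳ A a≈b (suc i) j = refl

  ∷-η : (A : Matrix (suc n) m) → A ≈ᴹ head A ∷ tail A
  ∷-η A zero    j = refl
  ∷-η A (suc i) j = refl

  vanishing-resp : ∀ n {f g : Matrix (suc n) m → Carrier} → (∀ A → f A ≈ g A) →
    RepeatedHeadVanishes n f → RepeatedHeadVanishes n g
  vanishing-resp zero    f≈g _ = _
  vanishing-resp (suc n) f≈g f-van a A = trans (sym (f≈g (a ∷ a ∷ A))) (f-van a A)

  alternating-resp : ∀ n {f g : Matrix n m → Carrier} → (∀ A → f A ≈ g A) → Alternating n f → Alternating n g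
  alternating-resp zero    f≈g f-cong A≈B = trans (sym (f≈g _)) (trans (f-cong A≈B) (f≈g _))
  alternating-resp (suc n) f≈g (f-cong , f-lin , f-van , f-tail) =
    (λ A≈B → trans (sym (f≈g _)) (trans (f-cong A≈B) (f≈g _))) ,
    (λ x a b A → trans (sym (f≈g _)) (trans (f-lin x a b A) (+-cong (*-congˡ (f≈g _)) (f≈g _)))) ,
    vanishing-resp n f≈g f-van ,
    (λ a → alternating-resp n (λ A → f≈g (a ∷ A)) (f-tail a))

  vanishing-combine : ∀ n x y {f g : Matrix (suc n) m → Carrier} →
    RepeatedHeadVanishes n f → RepeatedHeadVanishes n g → RepeatedHeadVanishes n (λ A → x * f A + y * g A)
  vanishing-combine zero    x y _ _ = _
  vanishing-combine (suc n) x y f-van g-van a A = trans (+-cong (*-congˡ (f-van a A)) (*-congˡ (g-van a A)))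
    (solve 2 (λ x y → x :* con (pos 0) :+ y :* con (pos 0) := con (pos 0)) refl x y)

  alternating-combine : ∀ n x y {f g : Matrix n m → Carrier} →
    Alternating n f → Alternating n g → Alternating n (λ A → x * f A + y * g A)
  alternating-combine zero x y f-cong g-cong A≈B = +-cong (*-congˡ (f-cong A≈B)) (*-congˡ (g-cong A≈B))
  alternating-combine (suc n) x y (f-cong , f-lin , f-van , f-tail) (g-cong , g-lin , g-van , g-tail) =
    (λ A≈B → +-cong (*-congˡ (f-cong A≈B)) (*-congˡ (g-cong A≈B))) ,
    (λ z a b A → trans (+-cong (*-congˡ (f-lin z a b A)) (*-congˡ (g-lin z a b A)))
      (solve 7 (λ x y z fa fb ga gb → x :* (z :* fa :+ fb) :+ y :* (z :* ga :+ gb)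
                  := z :* (x :* fa :+ y :* ga) :+ (x :* fb :+ y :* gb)) refl x y z _ _ _ _)) ,
    vanishing-combine n x y f-van g-van ,
    (λ a → alternating-combine n x y (f-tail a) (g-tail a))

  tails : Matrix n (suc m) → Matrix n m
  tails A i = tail (A i)

  tails-∷ : ∀ a (A : Matrix n (suc m)) → tails (a ∷ A) ≈ᴹ tail a ∷ tails A
  tails-∷ a A zero    j = refl
  tails-∷ a A (suc i) j = refl

  -- Dropping the leading coordinate acts linearly on each vector separately. Needed for the second
  -- summand of `laplace-∷`.
  alternating-tails : ∀ n {f : Matrix n m → Carrier} → Alternating n f → Alternating n (λ A → f (tails A))
  alternating-tails zero    f-cong A≈B = f-cong (λ i j → A≈B i (suc j))
  alternating-tails (suc n) {f} (f-cong , f-lin , f-van , f-tail) =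
    (λ A≈B → f-cong (λ i j → A≈B i (suc j))) ,
    (λ x a b A → trans (f-cong (tails-∷ _ A)) (trans (f-lin x (tail a) (tail b) (tails A))
      (sym (+-cong (*-congˡ (f-cong (tails-∷ a A))) (f-cong (tails-∷ b A)))))) ,
    van n f-cong f-van ,
    (λ a → alternating-resp n (λ A → sym (f-cong (tails-∷ a A))) (alternating-tails n (f-tail (tail a))))
    where
    van : ∀ n {f : Matrix (suc n) m → Carrier} → Congruent f → RepeatedHeadVanishes n f →
      RepeatedHeadVanishes n (λ A → f (tails A))
    van zero    f-cong _ = _
    van (suc n) f-cong f-van a A =
      trans (f-cong (≈ᴹ.trans (tails-∷ a (a ∷ A)) (∷-congˡ (tail a) (tails-∷ a A)))) (f-van (tail a) (tails A))

  -- Expansion along the leading coordinates of the vectors. When f is the determinant of the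
  -- transpose, this is by definition the determinant of the transpose one size larger.
  laplace : (Matrix n m → Carrier) → Matrix (suc n) (suc m) → Carrier
  laplace f A = sum λ j → (- 1#) ^ toℕ j * A j zero * f (tails (removeAt A j))

  laplace-cong : {f : Matrix n m → Carrier} → Congruent f → Congruent (laplace f)
  laplace-cong f-cong A≈B = sum-cong-≋ (λ j →
    *-cong (*-congˡ {x = (- 1#) ^ toℕ j} (A≈B j zero)) (f-cong (λ k i → A≈B (punchIn j k) (suc i))))

  laplace-resp : {f g : Matrix n m → Carrier} → (∀ A → f A ≈ g A) → ∀ A → laplace f A ≈ laplace g A
  laplace-resp f≈g A = sum-cong-≋ (λ j → *-congˡ {x = (- 1#) ^ toℕ j * A j zero} (f≈g (tails (removeAt A j))))

  laplace-linear : ∀ x (f g : Matrix n m → Carrier) A →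
    laplace (λ B → x * f B + g B) A ≈ x * laplace f A + laplace g A
  laplace-linear x f g A = begin
    laplace (λ B → x * f B + g B) A        ≈⟨ sum-cong-≋ (λ j → solve 4 (λ s x f g → s :* (x :* f :+ g) := x :* (s :* f) :+ s :* g)
                                                refl (s j) x (f (minor j)) (g (minor j))) ⟩
    sum (λ j → x * (s j * f (minor j)) + s j * g (minor j))
                                            ≈⟨ ∑-distrib-+ (λ j → x * (s j * f (minor j))) (λ j → s j * g (minor j)) ⟩
    sum (λ j → x * (s j * f (minor j))) + laplace g A
                                            ≈⟨ +-congʳ (*-distribˡ-sum x (λ j → s j * f (minor j))) ⟨
    x * laplace f A + laplace g A          ∎
    where
    s = λ j → (- 1#) ^ toℕ j * A j zero
    minor = λ j → tails (removeAt A j)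

  -- The minor at index 0 loses `a`; every other minor keeps `tail a` as its head, and the shift of
  -- the index by one costs the factor -1.
  laplace-∷ : {f : Matrix (suc n) m → Carrier} → Congruent f → ∀ a A →
    laplace f (a ∷ A) ≈ - 1# * laplace (λ B → f (tail a ∷ B)) A + head a * f (tails A)
  laplace-∷ {f = f} f-cong a A = begin
    1# * head a * f (tails A) + sum (λ j → - 1# * (- 1#) ^ toℕ j * A j zero * f (tails (removeAt (a ∷ A) (suc j))))
      ≈⟨ +-cong (*-congʳ (*-identityˡ (head a))) (sum-cong-≋ (λ j → trans (*-congˡ (f-cong (minor j)))
           (solve 3 (λ s x y → con -1ℤ :* s :* x :* y := con -1ℤ :* (s :* x :* y)) refl ((- 1#) ^ toℕ j) (A j zero) _))) ⟩
    head a * f (tails A) + sum (λ j → - 1# * ((- 1#) ^ toℕ j * A j zero * f (tail a ∷ tails (removeAt A j))))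
      ≈⟨ +-congˡ (*-distribˡ-sum (- 1#) (λ j → (- 1#) ^ toℕ j * A j zero * f (tail a ∷ tails (removeAt A j)))) ⟨
    head a * f (tails A) + - 1# * laplace (λ B → f (tail a ∷ B)) A
      ≈⟨ +-comm _ _ ⟩
    - 1# * laplace (λ B → f (tail a ∷ B)) A + head a * f (tails A) ∎
    where
    minor : ∀ j → tails (removeAt (a ∷ A) (suc j)) ≈ᴹ tail a ∷ tails (removeAt A j)
    minor j zero    i = refl
    minor j (suc k) i = refl

  laplace-single : {f : Matrix 0 m → Carrier} → Congruent f → ∀ a A →
    laplace f (a ∷ A) ≈ head a * f (λ ())
  laplace-single f-cong a A = trans (+-identityʳ _) (*-cong (*-identityˡ _) (f-cong (λ ())))

  -- By `laplace-∷`, fixing the first vector turns `laplace f` into a combination of a smaller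
  -- Laplace expansion and of `f` on truncated vectors, both alternating in the remaining vectors.
  -- For two equal leading vectors the two terms cancel.
  laplace-alternating : ∀ n {f : Matrix n m → Carrier} → Alternating n f → Alternating (suc n) (laplace f)
  laplace-alternating zero {f} f-cong =
    laplace-cong f-cong ,
    (λ x a b A → trans (laplace-single f-cong (λ i → x * a i + b i) A)
      (trans (solve 4 (λ x a b y → (x :* a :+ b) :* y := x :* (a :* y) :+ b :* y) refl x (head a) (head b) (f (λ ())))
             (sym (+-cong (*-congˡ (laplace-single f-cong a A)) (laplace-single f-cong b A))))) ,
    _ ,
    (λ a A≈B → laplace-cong f-cong (∷-congˡ a A≈B))
  laplace-alternating (suc n) {f} F@(f-cong , f-lin , f-van , f-tail) =
    laplace-cong f-cong ,
    (λ x a b A → begin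
      laplace f ((λ i → x * a i + b i) ∷ A)
        ≈⟨ laplace-∷ f-cong _ A ⟩
      - 1# * laplace (λ B → f ((λ i → x * a (suc i) + b (suc i)) ∷ B)) A + (x * head a + head b) * f (tails A)
        ≈⟨ +-congʳ (*-congˡ (trans (laplace-resp (f-lin x (tail a) (tail b)) A)
             (laplace-linear x (λ B → f (tail a ∷ B)) (λ B → f (tail b ∷ B)) A))) ⟩
      - 1# * (x * laplace (λ B → f (tail a ∷ B)) A + laplace (λ B → f (tail b ∷ B)) A) + (x * head a + head b) * f (tails A)
        ≈⟨ solve 6 (λ x la lb a b y → con -1ℤ :* (x :* la :+ lb) :+ (x :* a :+ b) :* y
             := x :* (con -1ℤ :* la :+ a :* y) :+ (con -1ℤ :* lb :+ b :* y)) refl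
             x (laplace (λ B → f (tail a ∷ B)) A) (laplace (λ B → f (tail b ∷ B)) A) (head a) (head b) (f (tails A)) ⟩
      x * (- 1# * laplace (λ B → f (tail a ∷ B)) A + head a * f (tails A))
        + (- 1# * laplace (λ B → f (tail b ∷ B)) A + head b * f (tails A))
        ≈⟨ +-cong (*-congˡ (laplace-∷ f-cong a A)) (laplace-∷ f-cong b A) ⟨
      x * laplace f (a ∷ A) + laplace f (b ∷ A) ∎) ,
    (λ a A → begin
      laplace f (a ∷ a ∷ A)
        ≈⟨ laplace-∷ f-cong a (a ∷ A) ⟩
      - 1# * laplace (λ B → f (tail a ∷ B)) (a ∷ A) + head a * f (tails (a ∷ A))
        ≈⟨ +-cong (*-congˡ (repeated n f-van f-tail a A)) (*-congˡ (f-cong (tails-∷ a A))) ⟩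
      - 1# * (head a * f (tail a ∷ tails A)) + head a * f (tail a ∷ tails A)
        ≈⟨ solve 1 (λ y → con -1ℤ :* y :+ y := con (pos 0)) refl _ ⟩
      0# ∎) ,
    (λ a → alternating-resp (suc n) (λ A → sym (laplace-∷ f-cong a A))
      (alternating-combine (suc n) (- 1#) (head a)
        (laplace-alternating n (f-tail (tail a))) (alternating-tails (suc n) F)))
    where
    -- Expanding along the second copy of `a`, every minor that keeps it contains `tail a` twice in
    -- front and vanishes; only the minor that loses it survives.
    repeated : ∀ n {f : Matrix (suc n) m → Carrier} → RepeatedHeadVanishes n f →
      (∀ a → Alternating n (λ A → f (a ∷ A))) → ∀ a A →
      laplace (λ B → f (tail a ∷ B)) (a ∷ A) ≈ head a * f (tail a ∷ tails A)
    repeated zero {f} f-van f-tail a A = trans (laplace-single (f-tail (tail a)) a A) (*-congˡ (f-tail (tail a) (λ ())))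
    repeated (suc n) {f} f-van f-tail a A = begin
      laplace (λ B → f (tail a ∷ B)) (a ∷ A)
        ≈⟨ laplace-∷ (alternating⇒congruent (suc n) (f-tail (tail a))) a A ⟩
      - 1# * laplace (λ B → f (tail a ∷ tail a ∷ B)) A + head a * f (tail a ∷ tails A)
        ≈⟨ +-congʳ (*-congˡ (weighted-sum-zero (λ j → (- 1#) ^ toℕ j * A j zero) (λ j → f-van (tail a) (tails (removeAt A j))))) ⟩
      - 1# * 0# + head a * f (tail a ∷ tails A)
        ≈⟨ trans (+-congʳ (zeroʳ _)) (+-identityˡ _) ⟩
      head a * f (tail a ∷ tails A) ∎

  det-transpose-alternating : ∀ n → Alternating n (λ (A : Matrix n n) → det (transpose A))
  det-transpose-alternating zero    _ = refl
  det-transpose-alternating (suc n) = laplace-alternating n (det-transpose-alternating n)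

  det-cong : ∀ n {A B : Matrix n n} → A ≈ᴹ B → det A ≈ det B
  det-cong n A≈B = alternating⇒congruent n (det-transpose-alternating n) (transpose-cong A≈B)

  -- Polarisation: f vanishes at (a + b, a + b), and of the four terms of its expansion the two with
  -- a repeated vector vanish as well.
  alternating-swap : ∀ {f : Matrix (suc (suc n)) m → Carrier} → Alternating (suc (suc n)) f → ∀ a b A →
    f (a ∷ b ∷ A) ≈ - f (b ∷ a ∷ A)
  alternating-swap {f = f} (f-cong , f-lin , f-van , f-tail) a b A = begin
    f (a ∷ b ∷ A)
      ≈⟨ solve 2 (λ x y → x := con (pos 1) :* (con (pos 1) :* con (pos 0) :+ x) :+ (con (pos 1) :* y :+ con (pos 0)) :- y) refl _ _ ⟩
    1# * (1# * 0# + f (a ∷ b ∷ A)) + (1# * f (b ∷ a ∷ A) + 0#) - f (b ∷ a ∷ A)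
      ≈⟨ +-congʳ (+-cong (*-congˡ (+-congʳ (*-congˡ (f-van a A)))) (+-congˡ (f-van b A))) ⟨
    1# * (1# * f (a ∷ a ∷ A) + f (a ∷ b ∷ A)) + (1# * f (b ∷ a ∷ A) + f (b ∷ b ∷ A)) - f (b ∷ a ∷ A)
      ≈⟨ +-congʳ (+-cong (*-congˡ (second a)) (second b)) ⟨
    1# * f (a ∷ a+b ∷ A) + f (b ∷ a+b ∷ A) - f (b ∷ a ∷ A)
      ≈⟨ +-congʳ (trans (sym (f-lin 1# a b (a+b ∷ A))) (f-van a+b A)) ⟩
    0# - f (b ∷ a ∷ A)
      ≈⟨ +-identityˡ _ ⟩
    - f (b ∷ a ∷ A) ∎
    where
    a+b = λ i → 1# * a i + b i
    second : ∀ v → f (v ∷ a+b ∷ A) ≈ 1# * f (v ∷ a ∷ A) + f (v ∷ b ∷ A)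
    second v with _ , lin , _ ← f-tail v = lin 1# a b A

  alternating-zero : {f : Matrix (suc n) m → Carrier} → Alternating (suc n) f → ∀ A → f ((λ _ → 0#) ∷ A) ≈ 0#
  alternating-zero {f = f} (f-cong , f-lin , _) A = begin
    f (0ᵛ ∷ A)                                 ≈⟨ solve 1 (λ y → y := con (pos 1) :* y :+ y :- y) refl _ ⟩
    1# * f (0ᵛ ∷ A) + f (0ᵛ ∷ A) - f (0ᵛ ∷ A)  ≈⟨ +-congʳ (f-lin 1# 0ᵛ 0ᵛ A) ⟨
    f ((λ _ → 1# * 0# + 0#) ∷ A) - f (0ᵛ ∷ A)  ≈⟨ +-congʳ (f-cong (∷-congʳ A (λ _ → trans (+-congʳ (zeroʳ 1#)) (+-identityʳ 0#)))) ⟩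
    f (0ᵛ ∷ A) - f (0ᵛ ∷ A)                    ≈⟨ -‿inverseʳ _ ⟩
    0#                                         ∎
    where
    0ᵛ = λ _ → 0#

  -- Multiples of one vector a are added to all arguments. Terms that use a twice vanish, so the
  -- result is affine in e; moving a from position k to the front takes k swaps.
  alternating-expand : ∀ n {f : Matrix (suc n) m → Carrier} → Alternating (suc n) f →
    ∀ (e : Vector Carrier (suc n)) a C →
    f (λ k i → e k * a i + C k i) ≈ f C + sum (λ k → (- 1#) ^ toℕ k * e k * f (a ∷ removeAt C k))
  alternating-expand zero {f} (f-cong , f-lin , _) e a C = begin
    f (λ k i → e k * a i + C k i)                         ≈⟨ f-cong (∷-η _) ⟩
    f ((λ i → e zero * a i + C zero i) ∷ _)               ≈⟨ f-lin (e zero) a (C zero) _ ⟩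
    e zero * f (a ∷ _) + f (C zero ∷ _)
      ≈⟨ +-cong (*-congˡ (f-cong {B = a ∷ removeAt C zero} (∷-congˡ a (λ ())))) (f-cong {B = C} (λ { zero _ → refl })) ⟩
    e zero * f (a ∷ removeAt C zero) + f C
      ≈⟨ solve 3 (λ e x y → e :* x :+ y := y :+ (con (pos 1) :* e :* x :+ con (pos 0))) refl (e zero) _ _ ⟩
    f C + (1# * e zero * f (a ∷ removeAt C zero) + 0#)    ∎
  alternating-expand (suc n) {f} F@(f-cong , f-lin , f-van , f-tail) e a C = begin
    f (λ k i → e k * a i + C k i)                         ≈⟨ f-cong (∷-η _) ⟩
    f ((λ i → e zero * a i + C zero i) ∷ R)               ≈⟨ f-lin (e zero) a (C zero) R ⟩
    e zero * f (a ∷ R) + f (C zero ∷ R)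
      ≈⟨ +-cong (*-congˡ (trans (alternating-expand n (f-tail a) (tail e) a (tail C))
           (trans (+-congˡ (weighted-sum-zero (λ k → (- 1#) ^ toℕ k * e (suc k)) (λ k → f-van a (removeAt (tail C) k)))) (+-identityʳ _))))
           (alternating-expand n (f-tail (C zero)) (tail e) a (tail C)) ⟩
    e zero * f (a ∷ tail C) + (f (C zero ∷ tail C) + sum (λ k → (- 1#) ^ toℕ k * e (suc k) * f (C zero ∷ a ∷ removeAt (tail C) k)))
      ≈⟨ +-congˡ (+-cong (sym (f-cong (∷-η C))) (sum-cong-≋ moved)) ⟩
    e zero * f (a ∷ tail C) + (f C + sum (λ k → (- 1#) ^ toℕ (suc k) * e (suc k) * f (a ∷ removeAt C (suc k))))
      ≈⟨ solve 4 (λ e x y z → e :* x :+ (y :+ z) := y :+ (con (pos 1) :* e :* x :+ z)) refl (e zero) _ _ _ ⟩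
    f C + (1# * e zero * f (a ∷ removeAt C zero) + sum (λ k → (- 1#) ^ toℕ (suc k) * e (suc k) * f (a ∷ removeAt C (suc k)))) ∎
    where
    R = λ k i → e (suc k) * a i + C (suc k) i
    moved : ∀ k → (- 1#) ^ toℕ k * e (suc k) * f (C zero ∷ a ∷ removeAt (tail C) k)
      ≈ (- 1#) ^ toℕ (suc k) * e (suc k) * f (a ∷ removeAt C (suc k))
    moved k = begin
      (- 1#) ^ toℕ k * e (suc k) * f (C zero ∷ a ∷ removeAt (tail C) k)
        ≈⟨ *-congˡ (alternating-swap F (C zero) a (removeAt (tail C) k)) ⟩
      (- 1#) ^ toℕ k * e (suc k) * - f (a ∷ C zero ∷ removeAt (tail C) k)
        ≈⟨ solve 3 (λ s e y → s :* e :* :- y := con -1ℤ :* s :* e :* y) refl ((- 1#) ^ toℕ k) (e (suc k)) _ ⟩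
      - 1# * (- 1#) ^ toℕ k * e (suc k) * f (a ∷ C zero ∷ removeAt (tail C) k)
        ≈⟨ *-congˡ (f-cong (∷-congˡ a (∷-η (removeAt C (suc k))))) ⟨
      (- 1#) ^ toℕ (suc k) * e (suc k) * f (a ∷ removeAt C (suc k)) ∎

  -- The arguments are n combinations of only l < n vectors. Splitting off one generator leaves a
  -- term with fewer generators and terms with one generator and one argument fewer. With no
  -- generators left the leading argument is the zero vector.
  alternating-dependent : ∀ n {f : Matrix n m → Carrier} → Alternating n f → l ℕ.< n →
    (E : Matrix l n) (A : Matrix l m) → f (transpose E *ᴹ A) ≈ 0#
  alternating-dependent {l = zero} (suc n) {f} F@(f-cong , _) _ E A =
    trans (f-cong (∷-η _)) (alternating-zero F _)
  alternating-dependent {l = suc l} (suc n) {f} F@(_ , _ , _ , f-tail) (s<s l<n) E A = begin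
    f (transpose E *ᴹ A)
      ≈⟨ alternating-expand n F (head E) (head A) (transpose (tail E) *ᴹ tail A) ⟩
    f (transpose (tail E) *ᴹ tail A)
      + sum (λ k → (- 1#) ^ toℕ k * head E k * f (head A ∷ removeAt (transpose (tail E) *ᴹ tail A) k))
      ≈⟨ +-cong (alternating-dependent (suc n) F (ℕ.m<n⇒m<1+n l<n) (tail E) (tail A))
           (weighted-sum-zero (λ k → (- 1#) ^ toℕ k * head E k)
             (λ k → alternating-dependent n (f-tail (head A)) l<n (λ j → removeAt (E (suc j)) k) (tail A))) ⟩
    0# + 0#
      ≈⟨ +-identityˡ 0# ⟩
    0# ∎

  -- The same splitting with as many generators as arguments: the term without the first generator
  -- vanishes by `alternating-dependent`, and the others assemble the expansion of `det E` along its
  -- first row.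
  alternating-det : ∀ n {f : Matrix n m → Carrier} → Alternating n f →
    (E : Matrix n n) (A : Matrix n m) → f (transpose E *ᴹ A) ≈ det E * f A
  alternating-det zero    f-cong E A = trans (f-cong (λ ())) (sym (*-identityˡ _))
  alternating-det (suc n) {f} F@(f-cong , _ , _ , f-tail) E A = begin
    f (transpose E *ᴹ A)
      ≈⟨ alternating-expand n F (head E) (head A) (transpose (tail E) *ᴹ tail A) ⟩
    f (transpose (tail E) *ᴹ tail A)
      + sum (λ k → (- 1#) ^ toℕ k * head E k * f (head A ∷ removeAt (transpose (tail E) *ᴹ tail A) k))
      ≈⟨ +-cong (alternating-dependent (suc n) F (ℕ.n<1+n n) (tail E) (tail A))
           (sum-cong-≋ (λ k → trans (*-congˡ {x = (- 1#) ^ toℕ k * head E k} (alternating-det n (f-tail (head A)) (minor k) (tail A))) (sym (*-assoc _ _ _)))) ⟩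
    0# + sum (λ k → (- 1#) ^ toℕ k * head E k * det (minor k) * f (head A ∷ tail A))
      ≈⟨ +-identityˡ _ ⟩
    sum (λ k → (- 1#) ^ toℕ k * head E k * det (minor k) * f (head A ∷ tail A))
      ≈⟨ *-distribʳ-sum _ (λ k → (- 1#) ^ toℕ k * head E k * det (minor k)) ⟨
    det E * f (head A ∷ tail A)
      ≈⟨ *-congˡ (f-cong (∷-η A)) ⟨
    det E * f A ∎
    where
    minor = λ k j → removeAt (E (suc j)) k

  -- Take f to be the determinant of the transpose, evaluated at the rows of Aᵀ with coefficient
  -- matrix B. Since BᵀAᵀ = (AB)ᵀ, its value is `det (A *ᴹ B)`, and `det B` comes out in front.
  det-*ᴹ : ∀ n (A B : Matrix n n) → det (A *ᴹ B) ≈ det B * det A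
  det-*ᴹ n A B = trans (det-cong n (transpose-cong (transpose-*ᴹ A B)))
    (alternating-det n (det-transpose-alternating n) B (transpose A))

-- Polynomial functions, first-order jets and the trace of the resolvent.

module Spectra {c ℓ₁ ℓ₂ ℓ₃} (K : OrderedField c ℓ₁ ℓ₂ ℓ₃) where

  open OrderedField K hiding (zero; Carrier; _≈_; _#_; _+_; _*_; -_; _-_; 0#; 1#; #⇒invertible)
  open Over K
  open OrderedFieldProperties K
  open Matrices K
  open Determinants K
  open CommutativeRing commutativeRing using (*-commutativeMonoid)
  open import Algebra.Properties.CommutativeMonoid.Sum *-commutativeMonoid using ()
    renaming (sum-cong-≋ to product-cong; ∑-distrib-+ to product-distrib-*)
  open IntegerCoefficients commutativeRing using (module Solver)
  open Solver
  open List using (List; []; _∷_; length)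
  open All using (All; []; _∷_)
  open ≈-Reasoning

  ⟦_⟧ᵖ : List Carrier → Carrier → Carrier
  ⟦ []     ⟧ᵖ t = 0#
  ⟦ a ∷ as ⟧ᵖ t = a + t * ⟦ as ⟧ᵖ t

  infixl 6 _+ᵖ_
  infixl 7 _·ᵖ_ _*ᵖ_

  _+ᵖ_ : List Carrier → List Carrier → List Carrier
  []       +ᵖ bs       = bs
  (a ∷ as) +ᵖ []       = a ∷ as
  (a ∷ as) +ᵖ (b ∷ bs) = (a + b) ∷ (as +ᵖ bs)

  _·ᵖ_ : Carrier → List Carrier → List Carrier
  x ·ᵖ []       = []
  x ·ᵖ (a ∷ as) = (x * a) ∷ (x ·ᵖ as)

  _*ᵖ_ : List Carrier → List Carrier → List Carrier
  []       *ᵖ bs = []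
  (a ∷ as) *ᵖ bs = a ·ᵖ bs +ᵖ (0# ∷ as *ᵖ bs)

  ⟦⟧ᵖ-+ᵖ : ∀ as bs t → ⟦ as +ᵖ bs ⟧ᵖ t ≈ ⟦ as ⟧ᵖ t + ⟦ bs ⟧ᵖ t
  ⟦⟧ᵖ-+ᵖ []       bs       t = sym (+-identityˡ _)
  ⟦⟧ᵖ-+ᵖ (a ∷ as) []       t = sym (+-identityʳ _)
  ⟦⟧ᵖ-+ᵖ (a ∷ as) (b ∷ bs) t = trans (+-congˡ (*-congˡ (⟦⟧ᵖ-+ᵖ as bs t)))
    (solve 5 (λ a b t x y → a :+ b :+ t :* (x :+ y) := a :+ t :* x :+ (b :+ t :* y)) refl a b t _ _)

  ⟦⟧ᵖ-·ᵖ : ∀ x as t → ⟦ x ·ᵖ as ⟧ᵖ t ≈ x * ⟦ as ⟧ᵖ t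
  ⟦⟧ᵖ-·ᵖ x []       t = sym (zeroʳ x)
  ⟦⟧ᵖ-·ᵖ x (a ∷ as) t = trans (+-congˡ (*-congˡ (⟦⟧ᵖ-·ᵖ x as t)))
    (solve 4 (λ x a t y → x :* a :+ t :* (x :* y) := x :* (a :+ t :* y)) refl x a t _)

  ⟦⟧ᵖ-*ᵖ : ∀ as bs t → ⟦ as *ᵖ bs ⟧ᵖ t ≈ ⟦ as ⟧ᵖ t * ⟦ bs ⟧ᵖ t
  ⟦⟧ᵖ-*ᵖ []       bs t = sym (zeroˡ _)
  ⟦⟧ᵖ-*ᵖ (a ∷ as) bs t = begin
    ⟦ a ·ᵖ bs +ᵖ (0# ∷ as *ᵖ bs) ⟧ᵖ t                ≈⟨ ⟦⟧ᵖ-+ᵖ (a ·ᵖ bs) (0# ∷ as *ᵖ bs) t ⟩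
    ⟦ a ·ᵖ bs ⟧ᵖ t + (0# + t * ⟦ as *ᵖ bs ⟧ᵖ t)      ≈⟨ +-cong (⟦⟧ᵖ-·ᵖ a bs t) (+-congˡ (*-congˡ (⟦⟧ᵖ-*ᵖ as bs t))) ⟩
    a * ⟦ bs ⟧ᵖ t + (0# + t * (⟦ as ⟧ᵖ t * ⟦ bs ⟧ᵖ t))
      ≈⟨ solve 4 (λ a t x y → a :* y :+ (con (pos 0) :+ t :* (x :* y)) := (a :+ t :* x) :* y) refl a t _ _ ⟩
    ⟦ a ∷ as ⟧ᵖ t * ⟦ bs ⟧ᵖ t ∎

  -- The coefficients of s p(2t) - p(t).
  dilation : Carrier → List Carrier → List Carrier
  dilation s []       = []
  dilation s (a ∷ as) = ((s - 1#) * a) ∷ dilation (s + s) as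

  length-dilation : ∀ s as → length (dilation s as) ≡ length as
  length-dilation s []       = ≡.refl
  length-dilation s (a ∷ as) = ≡.cong suc (length-dilation (s + s) as)

  ⟦⟧ᵖ-dilation : ∀ s as t → ⟦ dilation s as ⟧ᵖ t ≈ s * ⟦ as ⟧ᵖ (t + t) - ⟦ as ⟧ᵖ t
  ⟦⟧ᵖ-dilation s []       t = solve 1 (λ s → con (pos 0) := s :* con (pos 0) :- con (pos 0)) refl s
  ⟦⟧ᵖ-dilation s (a ∷ as) t = trans (+-congˡ (*-congˡ (⟦⟧ᵖ-dilation (s + s) as t)))
    (solve 5 (λ s a t x y → (s :- con (pos 1)) :* a :+ t :* ((s :+ s) :* x :- y)
                := s :* (a :+ (t :+ t) :* x) :- (a :+ t :* y)) refl s a t _ _)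

  dilation-zero : ∀ {s} as → 0# < s - 1# → All (_≈ 0#) (dilation s as) → All (_≈ 0#) as
  dilation-zero []       1<s []                = []
  dilation-zero {s} (a ∷ as) 1<s (sa-a≈0 ∷ rest) =
    unit-cancelˡ a 0# (proj₂ (#0⇒unit (0<⇒#0 1<s))) (trans sa-a≈0 (sym (zeroʳ _))) ∷
    dilation-zero as
      -- The next factor is 2s - 1 = (s - 1) + (s - 1) + 1, so all the factors along the list stay
      -- positive.
      (<.<-respʳ-≈ (solve 1 (λ s → s :- con (pos 1) :+ (s :- con (pos 1)) :+ con (pos 1) := s :+ s :- con (pos 1)) refl s)
        (pos+nonneg (pos+nonneg 1<s (<.asym 1<s)) (<.asym 0<1)))
      rest

  ⟦⟧ᵖ-zero : ∀ {as} → All (_≈ 0#) as → ∀ t → ⟦ as ⟧ᵖ t ≈ 0#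
  ⟦⟧ᵖ-zero []           t = refl
  ⟦⟧ᵖ-zero (a≈0 ∷ as≈0) t = trans (+-cong a≈0 (trans (*-congˡ (⟦⟧ᵖ-zero as≈0 t)) (zeroʳ t))) (+-identityʳ 0#)

  -- Dilation t ↦ 2t eliminates the constant coefficient of a polynomial that
  -- vanishes away from 0, and a positive multiple of every other one survives.
  vanishing-polynomial : ∀ n as → length as ≡ n → (∀ t → t # 0# → ⟦ as ⟧ᵖ t ≈ 0#) → All (_≈ 0#) as
  vanishing-polynomial n       []       _  _   = []
  vanishing-polynomial (suc n) (a ∷ as) eq p≈0 = a≈0 ∷ as≈0
    where
    as≈0 : All (_≈ 0#) as
    as≈0 = dilation-zero as
      (<.<-respʳ-≈ (solve 0 (con (pos 1) := con (pos 1) :+ con (pos 1) :- con (pos 1)) refl) 0<1)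
      -- The dilated list is no sublist of the original, so the recursion runs on the length n. The
      -- factor s = 2 comes from p = a + t q, for which p(2t) - p(t) = t (2 q(2t) - q(t)).
      -- Cancelling t requires t # 0, which is why the hypothesis speaks only of such t.
      (vanishing-polynomial n (dilation (1# + 1#) as)
        (≡.trans (length-dilation (1# + 1#) as) (ℕ.suc-injective eq))
        (λ t t#0 → unit-cancelˡ _ 0# (proj₂ (#0⇒unit t#0)) (begin
          t * ⟦ dilation (1# + 1#) as ⟧ᵖ t
            ≈⟨ *-congˡ (⟦⟧ᵖ-dilation (1# + 1#) as t) ⟩
          t * ((1# + 1#) * ⟦ as ⟧ᵖ (t + t) - ⟦ as ⟧ᵖ t)
            ≈⟨ solve 4 (λ t a x y → t :* (con (pos 2) :* x :- y) := a :+ (t :+ t) :* x :- (a :+ t :* y))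
                 refl t a (⟦ as ⟧ᵖ (t + t)) (⟦ as ⟧ᵖ t) ⟩
          ⟦ a ∷ as ⟧ᵖ (t + t) - ⟦ a ∷ as ⟧ᵖ t
            ≈⟨ +-cong (p≈0 (t + t) (+-double-#0 t#0)) (-‿cong (p≈0 t t#0)) ⟩
          0# - 0#
            ≈⟨ solve 1 (λ t → con (pos 0) :- con (pos 0) := t :* con (pos 0)) refl t ⟩
          t * 0# ∎)))
    a≈0 : a ≈ 0#
    a≈0 = begin
      a                    ≈⟨ trans (+-congˡ (trans (*-congˡ (⟦⟧ᵖ-zero as≈0 1#)) (zeroʳ 1#))) (+-identityʳ a) ⟨
      ⟦ a ∷ as ⟧ᵖ 1#       ≈⟨ p≈0 1# (0<⇒#0 0<1) ⟩
      0#                   ∎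

  -- f is a polynomial function beginning a + b t. The higher coefficients are hidden in the
  -- witness: their existence is what makes b determined by f.
  HasJet : (Carrier → Carrier) → Carrier → Carrier → Set _
  HasJet f a b = ∃ λ as → ∀ t → f t ≈ ⟦ a ∷ b ∷ as ⟧ᵖ t

  jet-resp : ∀ {f g a a′ b b′} → (∀ t → g t ≈ f t) → a ≈ a′ → b ≈ b′ → HasJet f a b → HasJet g a′ b′
  jet-resp g≈f a≈a′ b≈b′ (as , eq) =
    as , λ t → trans (g≈f t) (trans (eq t) (+-cong a≈a′ (*-congˡ (+-congʳ b≈b′))))

  jet-affine : ∀ a b → HasJet (λ t → a + t * b) a b
  jet-affine a b = [] , λ t → solve 3 (λ a b t → a :+ t :* b := a :+ t :* (b :+ t :* con (pos 0))) refl a b t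

  jet-+ : ∀ {f g a a′ b b′} → HasJet f a b → HasJet g a′ b′ → HasJet (λ t → f t + g t) (a + a′) (b + b′)
  jet-+ (as , f≈) (bs , g≈) = as +ᵖ bs , λ t → trans (+-cong (f≈ t) (g≈ t)) (sym (⟦⟧ᵖ-+ᵖ (_ ∷ _ ∷ as) (_ ∷ _ ∷ bs) t))

  jet-* : ∀ {f g a a′ b b′} → HasJet f a b → HasJet g a′ b′ → HasJet (λ t → f t * g t) (a * a′) (a * b′ + b * a′)
  jet-* {f} {g} {a} {a′} {b} {b′} (as , f≈) (bs , g≈) =
    -- What remains of the product after its first two terms, divided by t².
    a ·ᵖ bs +ᵖ (b ∷ as) *ᵖ (b′ ∷ bs) +ᵖ a′ ·ᵖ as , λ t → begin
      f t * g t
        ≈⟨ *-cong (f≈ t) (g≈ t) ⟩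
      (a + t * (b + t * ⟦ as ⟧ᵖ t)) * (a′ + t * (b′ + t * ⟦ bs ⟧ᵖ t))
        ≈⟨ solve 7 (λ t a b x a′ b′ y → (a :+ t :* (b :+ t :* x)) :* (a′ :+ t :* (b′ :+ t :* y))
             := a :* a′ :+ t :* (a :* b′ :+ b :* a′ :+ t :* (a :* y :+ (b :+ t :* x) :* (b′ :+ t :* y) :+ a′ :* x)))
             refl t a b _ a′ b′ _ ⟩
      a * a′ + t * (a * b′ + b * a′ + t * (a * ⟦ bs ⟧ᵖ t + ⟦ b ∷ as ⟧ᵖ t * ⟦ b′ ∷ bs ⟧ᵖ t + a′ * ⟦ as ⟧ᵖ t))
        ≈⟨ +-congˡ (*-congˡ (+-congˡ (*-congˡ (trans (⟦⟧ᵖ-+ᵖ (a ·ᵖ bs +ᵖ (b ∷ as) *ᵖ (b′ ∷ bs)) (a′ ·ᵖ as) t) (+-cong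
             (trans (⟦⟧ᵖ-+ᵖ (a ·ᵖ bs) ((b ∷ as) *ᵖ (b′ ∷ bs)) t) (+-cong (⟦⟧ᵖ-·ᵖ a bs t) (⟦⟧ᵖ-*ᵖ (b ∷ as) (b′ ∷ bs) t)))
             (⟦⟧ᵖ-·ᵖ a′ as t)))))) ⟨
      ⟦ a * a′ ∷ a * b′ + b * a′ ∷ a ·ᵖ bs +ᵖ (b ∷ as) *ᵖ (b′ ∷ bs) +ᵖ a′ ·ᵖ as ⟧ᵖ t ∎

  jet-sum : {f : Fin n → Carrier → Carrier} {a b : Vector Carrier n} →
    (∀ i → HasJet (f i) (a i) (b i)) → HasJet (λ t → sum (λ i → f i t)) (sum a) (sum b)
  jet-sum {zero}  f-jet = [] , λ t → solve 1 (λ t → con (pos 0) := con (pos 0) :+ t :* (con (pos 0) :+ t :* con (pos 0))) refl t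
  jet-sum {suc n} f-jet = jet-+ (f-jet zero) (jet-sum (λ i → f-jet (suc i)))

  jet-product-1+ : (μ : Vector Carrier n) → HasJet (λ t → product (λ i → 1# + t * μ i)) 1# (sum μ)
  jet-product-1+ {zero}  μ = [] , λ t → solve 1 (λ t → con (pos 1) := con (pos 1) :+ t :* (con (pos 0) :+ t :* con (pos 0))) refl t
  jet-product-1+ {suc n} μ = jet-resp (λ _ → refl) (*-identityˡ 1#)
    (solve 2 (λ x y → con (pos 1) :* y :+ x :* con (pos 1) := x :+ y) refl _ _)
    (jet-* (jet-affine 1# (μ zero)) (jet-product-1+ (λ i → μ (suc i))))

  -- The derivative of `det` at A in the direction B, by the product rule in every term of the
  -- expansion along the first row.
  det′ : Matrix n n → Matrix n n → Carrier
  det′ {zero}  A B = 0#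
  det′ {suc n} A B = sum λ j →
    (- 1#) ^ toℕ j * A zero j * det′ (λ i k → A (suc i) (punchIn j k)) (λ i k → B (suc i) (punchIn j k)) +
    (- 1#) ^ toℕ j * B zero j * det (λ i k → A (suc i) (punchIn j k))

  jet-det : {F : Carrier → Matrix n n} {A B : Matrix n n} →
    (∀ i j → HasJet (λ t → F t i j) (A i j) (B i j)) → HasJet (λ t → det (F t)) (det A) (det′ A B)
  jet-det {zero}  F-jet = [] , λ t → solve 1 (λ t → con (pos 1) := con (pos 1) :+ t :* (con (pos 0) :+ t :* con (pos 0))) refl t
  jet-det {suc n} {F} {A} {B} F-jet = jet-sum (λ j →
    jet-* (signed j) (jet-det (λ i k → F-jet (suc i) (punchIn j k))))
    where
    signed : ∀ j → HasJet (λ t → (- 1#) ^ toℕ j * F t zero j) ((- 1#) ^ toℕ j * A zero j) ((- 1#) ^ toℕ j * B zero j)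
    signed j = jet-resp (λ t → *-congʳ (sym (trans (+-congˡ (zeroʳ t)) (+-identityʳ _)))) refl
      (trans (+-congˡ (zeroˡ _)) (+-identityʳ _)) (jet-* (jet-affine ((- 1#) ^ toℕ j) 0#) (F-jet zero j))

  -- The difference of the two polynomials vanishes at every t, so `vanishing-polynomial` kills all
  -- of its coefficients, the linear one among them.
  jet-unique : ∀ {f g a a′ b b′} → (∀ t → f t ≈ g t) → HasJet f a b → HasJet g a′ b′ → b ≈ b′
  jet-unique {f} {g} {a} {a′} {b} {b′} f≈g (as , f≈) (bs , g≈)
    = begin
      b                     ≈⟨ solve 2 (λ b b′ → b := b :+ con -1ℤ :* b′ :+ b′) refl b b′ ⟩
      b + - 1# * b′ + b′    ≈⟨ +-congʳ (second (vanishing-polynomial _ ((a ∷ b ∷ as) +ᵖ - 1# ·ᵖ (a′ ∷ b′ ∷ bs)) ≡.refl (λ t _ → difference t))) ⟩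
      0# + b′               ≈⟨ +-identityˡ b′ ⟩
      b′                    ∎
    where
    second : ∀ {x y zs} → All (_≈ 0#) (x ∷ y ∷ zs) → y ≈ 0#
    second (_ ∷ y≈0 ∷ _) = y≈0
    difference : ∀ t → ⟦ (a ∷ b ∷ as) +ᵖ - 1# ·ᵖ (a′ ∷ b′ ∷ bs) ⟧ᵖ t ≈ 0#
    difference t = begin
      ⟦ (a ∷ b ∷ as) +ᵖ - 1# ·ᵖ (a′ ∷ b′ ∷ bs) ⟧ᵖ t     ≈⟨ ⟦⟧ᵖ-+ᵖ (a ∷ b ∷ as) (- 1# ·ᵖ (a′ ∷ b′ ∷ bs)) t ⟩
      ⟦ a ∷ b ∷ as ⟧ᵖ t + ⟦ - 1# ·ᵖ (a′ ∷ b′ ∷ bs) ⟧ᵖ t ≈⟨ +-cong (sym (f≈ t)) (⟦⟧ᵖ-·ᵖ (- 1#) (a′ ∷ b′ ∷ bs) t) ⟩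
      f t + - 1# * ⟦ a′ ∷ b′ ∷ bs ⟧ᵖ t                   ≈⟨ +-cong (f≈g t) (*-congˡ (sym (g≈ t))) ⟩
      g t + - 1# * g t                                   ≈⟨ solve 1 (λ x → x :+ con -1ℤ :* x := con (pos 0)) refl (g t) ⟩
      0#                                                 ∎

  det-zero-column : (A : Matrix (suc n) (suc n)) → (∀ i → A i zero ≈ 0#) → det A ≈ 0#
  det-zero-column {n} A col≈0 = trans
    (alternating⇒congruent (suc n) alternating {transpose A} {(λ _ → 0#) Vector.∷ λ j i → A i (suc j)} (λ { zero i → col≈0 i ; (suc j) i → refl }))
    (alternating-zero alternating (λ j i → A i (suc j)))
    where
    alternating = det-transpose-alternating (suc n)

  -- Deleting a column other than the first keeps column 0, whose only nonzero entry lay in the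
  -- deleted row.
  det-identity-minor : ∀ n (j : Fin n) → det {n} (λ i k → 1ᴹ (suc i) (punchIn (suc j) k)) ≈ 0#
  det-identity-minor (suc n) j = det-zero-column (λ i k → 1ᴹ (suc i) (punchIn (suc j) k)) (λ i → refl)

  det-1ᴹ : ∀ n → det (1ᴹ {n}) ≈ 1#
  det-1ᴹ zero    = refl
  det-1ᴹ (suc n) = begin
    1# * 1# * det (1ᴹ {n}) + sum (λ j → (- 1#) ^ toℕ (suc j) * 0# * det (minor j))
      ≈⟨ +-cong (*-congˡ (det-1ᴹ n)) (weighted-sum-zero (λ j → (- 1#) ^ toℕ (suc j) * 0#) (det-identity-minor n)) ⟩
    1# * 1# * 1# + 0#
      ≈⟨ solve 0 (con (pos 1) :* con (pos 1) :* con (pos 1) :+ con (pos 0) := con (pos 1)) refl ⟩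
    1# ∎
    where
    minor : Fin n → Matrix n n
    minor j i k = 1ᴹ (suc i) (punchIn (suc j) k)

  -- Jacobi's formula at the identity. Beyond the first column, one half of each term carries an
  -- off-diagonal entry of the identity and the other half a vanishing minor of it.
  det′-1ᴹ : ∀ n (B : Matrix n n) → det′ 1ᴹ B ≈ tr B
  det′-1ᴹ zero    B = refl
  det′-1ᴹ (suc n) B = begin
    1# * 1# * det′ 1ᴹ B₀ + 1# * B zero zero * det (1ᴹ {n})
      + sum (λ j → s j * 0# * d j + s j * B zero (suc j) * det (minor j))
      ≈⟨ +-cong (+-cong (*-congˡ (det′-1ᴹ n B₀)) (*-congˡ (det-1ᴹ n)))
           (sum-zero (λ j → trans (+-congˡ (*-congˡ (det-identity-minor n j)))
             (solve 3 (λ s d b → s :* con (pos 0) :* d :+ s :* b :* con (pos 0) := con (pos 0)) refl (s j) (d j) (B zero (suc j))))) ⟩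
    1# * 1# * tr B₀ + 1# * B zero zero * 1# + 0#
      ≈⟨ solve 2 (λ x y → con (pos 1) :* con (pos 1) :* y :+ con (pos 1) :* x :* con (pos 1) :+ con (pos 0) := x :+ y) refl _ _ ⟩
    tr B ∎
    where
    B₀ : Matrix n n
    B₀ i k = B (suc i) (suc k)
    s : Fin n → Carrier
    s j = (- 1#) ^ toℕ (suc j)
    minor : Fin n → Matrix n n
    minor j i k = 1ᴹ (suc i) (punchIn (suc j) k)
    d : Fin n → Carrier
    d j = det′ (minor j) (λ i k → B (suc i) (punchIn (suc j) k))

  product-unit : ∀ (f : Vector Carrier n) z → product f * z ≈ 1# → ∀ i → ∃ λ y → f i * y ≈ 1#
  product-unit f z eq zero    = _ , trans (sym (*-assoc _ _ _)) eq
  product-unit f z eq (suc i) = product-unit (λ i → f (suc i)) (f zero * z)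
    (trans (solve 3 (λ x y z → y :* (x :* z) := x :* y :* z) refl (f zero) (product (λ i → f (suc i))) z) eq) i

  -- Comparing the terms linear in t of
  -- det (a + t - A) / det (a - A) = det (1 + t (a - A)⁻¹) = ∏ (1 + t / (a - θ α)).
  spectrum-resolvent : ∀ {A : Matrix n n} {θ} → IsSpectrum A θ → ∀ {a} ((M⁻¹ , _) : Invertibleᴹ (a ·ᴹ 1ᴹ -ᴹ A)) →
    Σ[ a#θ ∈ (∀ α → a # θ α) ] tr M⁻¹ ≈ sum (λ α → recip-diff (a#θ α))
  spectrum-resolvent {n} {A} {θ} spectrum {a} (M⁻¹ , _ , MM⁻¹≈1) = a#θ , (begin
    tr M⁻¹                                 ≈⟨ det′-1ᴹ n M⁻¹ ⟨
    det′ 1ᴹ M⁻¹                            ≈⟨ jet-unique char (jet-det (λ i j → jet-affine (1ᴹ i j) (M⁻¹ i j))) (jet-product-1+ μ) ⟩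
    sum μ                                  ∎)
    where
    M : Matrix n n
    M = a ·ᴹ 1ᴹ -ᴹ A
    det-M : det M * det M⁻¹ ≈ 1#
    det-M = trans (*-comm _ _) (trans (sym (det-*ᴹ n M M⁻¹)) (trans (det-cong n MM⁻¹≈1) (det-1ᴹ n)))
    -- At x = a the spectrum identity writes the unit `det M` as the product of all a - θ α, so each
    -- factor is itself a unit.
    a#θ : ∀ α → a # θ α
    a#θ α = unit⇒# (proj₁ unit) (proj₂ unit)
      where unit = product-unit (λ α → a - θ α) (det M⁻¹) (trans (*-congʳ (sym (spectrum a))) det-M) α
    μ : Vector Carrier n
    μ α = recip-diff (a#θ α)
    shift : ∀ t → M *ᴹ (1ᴹ +ᴹ t ·ᴹ M⁻¹) ≈ᴹ (a + t) ·ᴹ 1ᴹ -ᴹ A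
    shift t i j = begin
      (M *ᴹ (1ᴹ +ᴹ t ·ᴹ M⁻¹)) i j                      ≈⟨ *ᴹ-distribˡ-+ᴹ M 1ᴹ (t ·ᴹ M⁻¹) i j ⟩
      (M *ᴹ 1ᴹ) i j + (M *ᴹ (t ·ᴹ M⁻¹)) i j            ≈⟨ +-cong (*ᴹ-identityʳ M i j) (trans (*ᴹ-·ᴹ t M M⁻¹ i j) (*-congˡ (MM⁻¹≈1 i j))) ⟩
      a * 1ᴹ i j - A i j + t * 1ᴹ i j                  ≈⟨ solve 4 (λ a t e x → a :* e :- x :+ t :* e := (a :+ t) :* e :- x) refl a t (1ᴹ i j) (A i j) ⟩
      (a + t) * 1ᴹ i j - A i j                         ∎
    char : ∀ t → det (1ᴹ +ᴹ t ·ᴹ M⁻¹) ≈ product (λ α → 1# + t * μ α)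
    char t = unit-cancelˡ _ _ det-M (begin
      det M * det (1ᴹ +ᴹ t ·ᴹ M⁻¹)                             ≈⟨ *-comm _ _ ⟩
      det (1ᴹ +ᴹ t ·ᴹ M⁻¹) * det M                             ≈⟨ det-*ᴹ n M (1ᴹ +ᴹ t ·ᴹ M⁻¹) ⟨
      det (M *ᴹ (1ᴹ +ᴹ t ·ᴹ M⁻¹))                              ≈⟨ det-cong n (shift t) ⟩
      det ((a + t) ·ᴹ 1ᴹ -ᴹ A)                                 ≈⟨ spectrum (a + t) ⟩
      product (λ α → a + t - θ α)                              ≈⟨ product-cong factor ⟩
      product (λ α → (a - θ α) * (1# + t * μ α))               ≈⟨ product-distrib-* (λ α → a - θ α) (λ α → 1# + t * μ α) ⟩
      product (λ α → a - θ α) * product (λ α → 1# + t * μ α)   ≈⟨ *-congʳ (spectrum a) ⟨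
      det M * product (λ α → 1# + t * μ α)                     ∎)
      where
      factor : ∀ α → a + t - θ α ≈ (a - θ α) * (1# + t * μ α)
      factor α = begin
        a + t - θ α                              ≈⟨ solve 3 (λ a t x → a :+ t :- x := a :- x :+ t :* con (pos 1)) refl a t (θ α) ⟩
        a - θ α + t * 1#                         ≈⟨ +-congˡ (*-congˡ (recip-diff-inverse (a#θ α))) ⟨
        a - θ α + t * ((a - θ α) * μ α)          ≈⟨ solve 3 (λ d t m → d :+ t :* (d :* m) := d :* (con (pos 1) :+ t :* m)) refl (a - θ α) t (μ α) ⟩
        (a - θ α) * (1# + t * μ α)               ∎

-- Positive definite matrices: Schur complements, elimination and inversion.

module PositiveDefiniteMatrices {c ℓ₁ ℓ₂ ℓ₃} (K : OrderedField c ℓ₁ ℓ₂ ℓ₃) where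

  open OrderedField K hiding (zero; Carrier; _≈_; _#_; _+_; _*_; -_; _-_; 0#; 1#; #⇒invertible)
  open Over K
  open OrderedFieldProperties K
  open Matrices K
  open CommutativeRing commutativeRing using (semiring)
  open import Algebra.Properties.Semiring.Sum semiring
    using (sum-cong-≋; ∑-distrib-+; *-distribˡ-sum)
  open IntegerCoefficients commutativeRing using (module Solver)
  open Solver
  open Vector using (_∷_)

  infixr 7 _*ᵛ_
  _*ᵛ_ : Matrix m n → Vector Carrier n → Vector Carrier m
  (A *ᵛ x) i = sum λ j → A i j * x j

  quadraticForm : Matrix n n → Vector Carrier n → Carrier
  quadraticForm A x = sum λ i → x i * (A *ᵛ x) i

  quadraticForm-cong : {A B : Matrix n n} → A ≈ᴹ B → ∀ x → quadraticForm A x ≈ quadraticForm B x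
  quadraticForm-cong A≈B x = sum-cong-≋ (λ i → *-congˡ {x = x i} (sum-cong-≋ (λ j → *-congʳ (A≈B i j))))

  quadraticForm-+ᴹ : (A B : Matrix n n) → ∀ x → quadraticForm (A +ᴹ B) x ≈ quadraticForm A x + quadraticForm B x
  quadraticForm-+ᴹ A B x = begin
    sum (λ i → x i * sum (λ j → (A i j + B i j) * x j))
      ≈⟨ sum-cong-≋ (λ i → trans
           (*-congˡ {x = x i} (trans (sum-cong-≋ (λ j → distribʳ (x j) (A i j) (B i j))) (∑-distrib-+ (λ j → A i j * x j) (λ j → B i j * x j))))
           (distribˡ (x i) ((A *ᵛ x) i) ((B *ᵛ x) i))) ⟩
    sum (λ i → x i * (A *ᵛ x) i + x i * (B *ᵛ x) i)
      ≈⟨ ∑-distrib-+ (λ i → x i * (A *ᵛ x) i) (λ i → x i * (B *ᵛ x) i) ⟩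
    quadraticForm A x + quadraticForm B x ∎
    where open ≈-Reasoning

  -- A nonzero vector is given with a position i at which it is apart from 0, the form of the
  -- hypothesis that yields strict positivity over a Heyting field.
  PositiveDefinite : Matrix n n → Set _
  PositiveDefinite A = ∀ x i → x i # 0# → 0# < quadraticForm A x

  module _ (A : Matrix (suc n) (suc n)) (p⁻¹ : Carrier) (pp⁻¹≈1 : A zero zero * p⁻¹ ≈ 1#) where

    schur : Matrix n n
    schur i j = A (suc i) (suc j) - A (suc i) zero * p⁻¹ * A zero (suc j)

    pivotRow : Vector Carrier n → Carrier
    pivotRow y = sum λ j → A zero (suc j) * y j

    -- Back substitution: the head is the solution of equation zero with right-hand side b once the
    -- other unknowns are y.
    completion : Carrier → Vector Carrier n → Vector Carrier (suc n)
    completion b y = p⁻¹ * (b - pivotRow y) ∷ y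

    *ᵛ-completion-zero : ∀ b y → (A *ᵛ completion b y) zero ≈ b
    *ᵛ-completion-zero b y = begin
      A zero zero * (p⁻¹ * (b - pivotRow y)) + pivotRow y
        ≈⟨ solve 4 (λ p r b s → p :* (r :* (b :- s)) :+ s := p :* r :* (b :- s) :+ s) refl (A zero zero) p⁻¹ b (pivotRow y) ⟩
      A zero zero * p⁻¹ * (b - pivotRow y) + pivotRow y
        ≈⟨ +-congʳ (*-congʳ pp⁻¹≈1) ⟩
      1# * (b - pivotRow y) + pivotRow y
        ≈⟨ solve 2 (λ b s → con (pos 1) :* (b :- s) :+ s := b) refl b (pivotRow y) ⟩
      b ∎
      where open ≈-Reasoning

    -- Eliminating the head leaves the Schur complement. The case b = 0 yields its definiteness,
    -- general b the solution of linear systems.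
    *ᵛ-completion-suc : ∀ b y i →
      (A *ᵛ completion b y) (suc i) ≈ A (suc i) zero * p⁻¹ * b + (schur *ᵛ y) i
    *ᵛ-completion-suc b y i = begin
      A (suc i) zero * (p⁻¹ * (b - pivotRow y)) + sum (λ j → A (suc i) (suc j) * y j)
        ≈⟨ solve 5 (λ a r b s t → a :* (r :* (b :- s)) :+ t := a :* r :* b :+ (t :- a :* r :* s)) refl
             (A (suc i) zero) p⁻¹ b (pivotRow y) _ ⟩
      w * b + (sum (λ j → A (suc i) (suc j) * y j) - w * pivotRow y)
        ≈⟨ +-congˡ (+-congˡ (-‿cong (*-distribˡ-sum w (λ j → A zero (suc j) * y j)))) ⟩
      w * b + (sum (λ j → A (suc i) (suc j) * y j) - sum (λ j → w * (A zero (suc j) * y j)))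
        ≈⟨ +-congˡ (sum-distrib-- (λ j → A (suc i) (suc j) * y j) (λ j → w * (A zero (suc j) * y j))) ⟨
      w * b + sum (λ j → A (suc i) (suc j) * y j - w * (A zero (suc j) * y j))
        ≈⟨ +-congˡ (sum-cong-≋ (λ j → solve 4 (λ a w c y → a :* y :- w :* (c :* y) := (a :- w :* c) :* y) refl
             (A (suc i) (suc j)) w (A zero (suc j)) (y j))) ⟩
      w * b + (schur *ᵛ y) i ∎
      where
      open ≈-Reasoning
      w = A (suc i) zero * p⁻¹

    -- Completing y so that the zeroth entry of A x is 0 makes the form of A at x equal to that of
    -- the Schur complement at y.
    schur-positiveDefinite : PositiveDefinite A → PositiveDefinite schur
    schur-positiveDefinite A-pd y i yᵢ#0 = <.<-respʳ-≈ (begin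
      x zero * (A *ᵛ x) zero + sum (λ i → y i * (A *ᵛ x) (suc i))
        ≈⟨ +-cong (trans (*-congˡ (*ᵛ-completion-zero 0# y)) (zeroʳ (x zero)))
             (sum-cong-≋ (λ i → *-congˡ {x = y i} (trans (*ᵛ-completion-suc 0# y i) (trans (+-congʳ (zeroʳ _)) (+-identityˡ _))))) ⟩
      0# + quadraticForm schur y
        ≈⟨ +-identityˡ _ ⟩
      quadraticForm schur y ∎)
      (A-pd x (suc i) yᵢ#0)
      where
      open ≈-Reasoning
      x = completion 0# y

  quadraticForm-basis : (A : Matrix n n) (i : Fin n) → quadraticForm A (basis i) ≈ A i i
  quadraticForm-basis A i = trans (sum-basis i (A *ᵛ basis i))
    (trans (sum-cong-≋ (λ j → *-comm (A i j) (basis i j))) (sum-basis i (A i)))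

  diagonal-pos : {A : Matrix n n} → PositiveDefinite A → ∀ i → 0# < A i i
  diagonal-pos {A = A} A-pd i = <.<-respʳ-≈ (quadraticForm-basis A i)
    (A-pd (basis i) i (unit⇒#0 1# (trans (*-identityʳ _) (basis-≡ i))))

  -- Gaussian elimination needs no search for a pivot: the leading entry is
  -- positive, and the Schur complement is again positive definite.
  positiveDefinite-solve : {A : Matrix n n} → PositiveDefinite A → (b : Vector Carrier n) → ∃ λ x → ∀ i → (A *ᵛ x) i ≈ b i
  positiveDefinite-solve {zero}  A-pd b = (λ ()) , λ ()
  positiveDefinite-solve {suc n} {A} A-pd b = completion A p⁻¹ pp⁻¹≈1 (b zero) y , solves
    where
    pivot : ∃ λ y → A zero zero * y ≈ 1#
    pivot = #0⇒unit (0<⇒#0 (diagonal-pos {A = A} A-pd zero))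
    p⁻¹ = proj₁ pivot
    pp⁻¹≈1 = proj₂ pivot
    reduced : ∃ λ y → ∀ i → (schur A p⁻¹ pp⁻¹≈1 *ᵛ y) i ≈ b (suc i) - A (suc i) zero * p⁻¹ * b zero
    reduced = positiveDefinite-solve (schur-positiveDefinite A p⁻¹ pp⁻¹≈1 A-pd) _
    y = proj₁ reduced
    solves : ∀ i → (A *ᵛ completion A p⁻¹ pp⁻¹≈1 (b zero) y) i ≈ b i
    solves zero    = *ᵛ-completion-zero A p⁻¹ pp⁻¹≈1 (b zero) y
    solves (suc i) = trans (*ᵛ-completion-suc A p⁻¹ pp⁻¹≈1 (b zero) y i)
      (trans (+-congˡ (proj₂ reduced i)) (solve 2 (λ w b → w :+ (b :- w) := b) refl _ _))

  -- Solving for the basis vectors gives a right inverse R. By symmetry of A its transpose is a left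
  -- inverse, and the two must coincide.
  positiveDefinite-invertible : {A : Matrix n n} → transpose A ≈ᴹ A → PositiveDefinite A → Invertibleᴹ A
  positiveDefinite-invertible {n} {A} Aᵀ≈A A-pd = R , RA≈1 , AR≈1
    where
    open ≈ᴹ-Reasoning
    R : Matrix n n
    R i j = proj₁ (positiveDefinite-solve A-pd (basis j)) i
    AR≈1 : A *ᴹ R ≈ᴹ 1ᴹ
    AR≈1 i j = trans (proj₂ (positiveDefinite-solve A-pd (basis j)) i) (basis-sym j i)
    RᵀA≈1 : transpose R *ᴹ A ≈ᴹ 1ᴹ
    RᵀA≈1 = begin
      transpose R *ᴹ A             ≈⟨ *ᴹ-congˡ (transpose R) Aᵀ≈A ⟨
      transpose R *ᴹ transpose A   ≈⟨ transpose-*ᴹ A R ⟨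
      transpose (A *ᴹ R)           ≈⟨ transpose-cong AR≈1 ⟩
      transpose 1ᴹ                 ≈⟨ (λ i j → basis-sym j i) ⟩
      1ᴹ                           ∎
    R≈Rᵀ : R ≈ᴹ transpose R
    R≈Rᵀ = begin
      R                            ≈⟨ *ᴹ-identityˡ R ⟨
      1ᴹ *ᴹ R                      ≈⟨ *ᴹ-congʳ R RᵀA≈1 ⟨
      transpose R *ᴹ A *ᴹ R        ≈⟨ *ᴹ-assoc (transpose R) A R ⟩
      transpose R *ᴹ (A *ᴹ R)      ≈⟨ *ᴹ-congˡ (transpose R) AR≈1 ⟩
      transpose R *ᴹ 1ᴹ            ≈⟨ *ᴹ-identityʳ (transpose R) ⟩
      transpose R                  ∎
    RA≈1 : R *ᴹ A ≈ᴹ 1ᴹ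
    RA≈1 = ≈ᴹ.trans (*ᴹ-congʳ A R≈Rᵀ) RᵀA≈1

-- Graph Laplacians: energy, connectedness and the edge-deleted complete graph.

module GraphLaplacians {c ℓ₁ ℓ₂ ℓ₃} (K : OrderedField c ℓ₁ ℓ₂ ℓ₃) where

  open OrderedField K hiding (zero; Carrier; _≈_; _#_; _+_; _*_; -_; _-_; 0#; 1#; #⇒invertible)
  open Over K
  open OrderedFieldProperties K
  open Matrices K
  open PositiveDefiniteMatrices K
  open import Algebra.Apartness.Properties.HeytingCommutativeRing heytingCommutativeRing
    using (#-congʳ; x#0y#0→xy#0)
  open CommutativeRing commutativeRing using (semiring)
  open import Algebra.Properties.Semiring.Sum semiring
    using (sum-cong-≋; ∑-distrib-+; ∑-comm; *-distribˡ-sum; *-distribʳ-sum)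
  open IntegerCoefficients commutativeRing using (module Solver)
  open Solver
  open ≈-Reasoning

  indicator : ∀ {a} {A : Set a} → Dec A → Carrier
  indicator d = if does d then 1# else 0#

  indicator-yes : ∀ {a} {A : Set a} (d : Dec A) → A → indicator d ≈ 1#
  indicator-yes d a rewrite dec-true d a = refl

  indicator-no : ∀ {a} {A : Set a} (d : Dec A) → ¬ A → indicator d ≈ 0#
  indicator-no d ¬a rewrite dec-false d ¬a = refl

  indicator-*-nonneg : ∀ {a} {A : Set a} (d : Dec A) {x} → ¬ (x < 0#) → ¬ (indicator d * x < 0#)
  indicator-*-nonneg d x≮0 with does d
  ... | true  = x≮0 ∘ <.<-respˡ-≈ (*-identityˡ _)
  ... | false = <.irrefl (zeroˡ _)

  if-then-0 : ∀ b x → (if b then x else 0#) ≈ (if b then 1# else 0#) * x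
  if-then-0 true  x = sym (*-identityˡ x)
  if-then-0 false x = sym (zeroˡ x)

  module _ (G : SimpleGraph n) where
    open SimpleGraph G

    adjacency-sym : ∀ i j → adjacency G i j ≈ adjacency G j i
    adjacency-sym i j = reflexive (≡.cong (if_then 1# else 0#) (does-⇔ (mk⇔ ~-sym ~-sym) (i ~? j) (j ~? i)))

    laplacian-*ᵛ : ∀ x i → (laplacian G *ᵛ x) i ≈ sum (λ j → adjacency G i j * (x i - x j))
    laplacian-*ᵛ x i = begin
      sum (λ j → (degrees G i j - A i j) * x j)
        ≈⟨ sum-cong-≋ (λ j → trans (*-congʳ (+-congʳ (if-then-0 (does (i ≟ j)) (sum (A i)))))
             (solve 4 (λ e d a x → (e :* d :- a) :* x := e :* (d :* x) :- a :* x) refl (basis i j) (sum (A i)) (A i j) (x j))) ⟩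
      sum (λ j → basis i j * (sum (A i) * x j) - A i j * x j)
        ≈⟨ sum-distrib-- (λ j → basis i j * (sum (A i) * x j)) (λ j → A i j * x j) ⟩
      sum (λ j → basis i j * (sum (A i) * x j)) - sum (λ j → A i j * x j)
        ≈⟨ +-congʳ (trans (sum-basis i (λ j → sum (A i) * x j)) (*-distribʳ-sum (x i) (A i))) ⟩
      sum (λ j → A i j * x i) - sum (λ j → A i j * x j)
        ≈⟨ sum-distrib-- (λ j → A i j * x i) (λ j → A i j * x j) ⟨
      sum (λ j → A i j * x i - A i j * x j)
        ≈⟨ sum-cong-≋ (λ j → solve 3 (λ a x y → a :* x :- a :* y := a :* (x :- y)) refl (A i j) (x i) (x j)) ⟩
      sum (λ j → A i j * (x i - x j)) ∎
      where
      A = adjacency G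

    laplacian-rowSum : ∀ i → sum (laplacian G i) ≈ 0#
    laplacian-rowSum i = trans (sum-cong-≋ (λ j → sym (*-identityʳ (laplacian G i j))))
      (trans (laplacian-*ᵛ (λ _ → 1#) i)
        (weighted-sum-zero (adjacency G i) (λ j → -‿inverseʳ 1#)))

    -- In the second copy the indices are exchanged; symmetry of adjacency then merges x i (x i - x
    -- j) and x j (x j - x i) into a square. Doubling makes this a sum over ordered pairs whose
    -- terms are all nonnegative.
    laplacian-quadraticForm : ∀ x → quadraticForm (laplacian G) x + quadraticForm (laplacian G) x ≈
      sum (λ i → sum (λ j → adjacency G i j * ((x i - x j) * (x i - x j))))
    laplacian-quadraticForm x = begin
      quadraticForm (laplacian G) x + quadraticForm (laplacian G) x
        ≈⟨ +-cong form (trans form (∑-comm {n} {n} (λ i j → x i * (A i j * (x i - x j))))) ⟩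
      sum (λ i → sum (λ j → x i * (A i j * (x i - x j)))) + sum (λ j → sum (λ i → x i * (A i j * (x i - x j))))
        ≈⟨ ∑-distrib-+ (λ i → sum (λ j → x i * (A i j * (x i - x j)))) (λ j → sum (λ i → x i * (A i j * (x i - x j)))) ⟨
      sum (λ i → sum (λ j → x i * (A i j * (x i - x j))) + sum (λ j → x j * (A j i * (x j - x i))))
        ≈⟨ sum-cong-≋ (λ i → sym (∑-distrib-+ (λ j → x i * (A i j * (x i - x j))) (λ j → x j * (A j i * (x j - x i))))) ⟩
      sum (λ i → sum (λ j → x i * (A i j * (x i - x j)) + x j * (A j i * (x j - x i))))
        ≈⟨ sum-cong-≋ (λ i → sum-cong-≋ (λ j → trans (+-congˡ (*-congˡ {x = x j} (*-congʳ (adjacency-sym j i))))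
             (solve 3 (λ a x y → x :* (a :* (x :- y)) :+ y :* (a :* (y :- x)) := a :* ((x :- y) :* (x :- y))) refl
               (A i j) (x i) (x j)))) ⟩
      sum (λ i → sum (λ j → A i j * ((x i - x j) * (x i - x j)))) ∎
      where
      A = adjacency G
      form : quadraticForm (laplacian G) x ≈ sum (λ i → sum (λ j → x i * (A i j * (x i - x j))))
      form = sum-cong-≋ (λ i → trans (*-congˡ {x = x i} (laplacian-*ᵛ x i)) (*-distribˡ-sum (x i) (λ j → A i j * (x i - x j))))

    edge-term-nonneg : ∀ (x : Vector Carrier n) i j → ¬ (adjacency G i j * ((x i - x j) * (x i - x j)) < 0#)
    edge-term-nonneg x i j = indicator-*-nonneg (i ~? j) (square-nonneg (x i - x j))

    laplacian-nonneg : ∀ x → ¬ (quadraticForm (laplacian G) x < 0#)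
    laplacian-nonneg x q<0 = sum-nonneg (λ i → sum-nonneg (edge-term-nonneg x i))
      (<.<-respˡ-≈ (laplacian-quadraticForm x) (<.trans (+-monoˡ-< _ q<0) (<.<-respˡ-≈ (sym (+-identityˡ _)) q<0)))

    laplacian-pos : ∀ x {i j} → i ~ j → x i - x j # 0# → 0# < quadraticForm (laplacian G) x
    laplacian-pos x {i} {j} i~j xᵢ-xⱼ#0 = half-pos (<.<-respʳ-≈ (sym (laplacian-quadraticForm x))
      (sum-pos (λ i → sum-nonneg (edge-term-nonneg x i)) i (sum-pos (edge-term-nonneg x i) j
        (<.<-respʳ-≈ (sym (trans (*-congʳ (indicator-yes (i ~? j) i~j)) (*-identityˡ _))) (square-pos xᵢ-xⱼ#0)))))

    -- The difference of x between the ends of a path is the sum of the differences along its edges,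
    -- and `+-#0` locates one that is apart from 0.
    separating-edge : ∀ (x : Vector Carrier n) {i j} → Star _~_ i j → x i - x j # 0# → ∃ λ k → ∃ λ l → k ~ l × x k - x l # 0#
    separating-edge x {i} ε                  d#0 = ⊥-elim (#-irrefl (-‿inverseʳ (x i)) d#0)
    separating-edge x {i} {j} (_◅_ {j = k} i~k k⋆j) d#0
      with +-#0 (#-congʳ (solve 3 (λ a b c → a :- c := a :- b :+ (b :- c)) refl (x i) (x k) (x j)) d#0)
    ... | inj₁ xᵢ-xₖ#0 = i , k , i~k , xᵢ-xₖ#0
    ... | inj₂ xₖ-xⱼ#0 = separating-edge x k⋆j xₖ-xⱼ#0

  quadraticForm-ones : (x : Vector Carrier n) → quadraticForm ones x ≈ sum x * sum x
  quadraticForm-ones x = trans (sum-cong-≋ (λ i → *-congˡ {x = x i} (sum-cong-≋ (λ j → *-identityˡ (x j)))))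
    (sym (*-distribʳ-sum (sum x) x))

  -- By n x i = ∑ (x i - x j) + ∑ x, one of these two sums is apart from 0. If it is the total, the
  -- all-ones part of the form is positive; otherwise some x i - x j is apart from 0, and a path
  -- from i to j contains an edge with positive energy.
  connected⇒positiveDefinite : (G : SimpleGraph n) → Connected G → PositiveDefinite (laplacian G +ᴹ ones)
  connected⇒positiveDefinite {suc n} G connected x i xᵢ#0 =
    <.<-respʳ-≈ (sym (trans (quadraticForm-+ᴹ (laplacian G) ones x) (+-congˡ (quadraticForm-ones x))))
      (positive (+-#0 (#-congʳ split (x#0y#0→xy#0 (0<⇒#0 (fromℕ-pos n)) xᵢ#0))))
    where
    split : fromℕ (suc n) * x i ≈ sum (λ j → x i - x j) + sum x
    split = begin
      fromℕ (suc n) * x i                        ≈⟨ *-congʳ (sum-ones (suc n)) ⟨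
      sum {suc n} (λ _ → 1#) * x i               ≈⟨ *-distribʳ-sum (x i) (λ (_ : Fin (suc n)) → 1#) ⟩
      sum {suc n} (λ _ → 1# * x i)               ≈⟨ sum-cong-≋ (λ j → solve 2 (λ x y → con (pos 1) :* x := x :- y :+ y) refl (x i) (x j)) ⟩
      sum (λ j → x i - x j + x j)                ≈⟨ ∑-distrib-+ (λ j → x i - x j) x ⟩
      sum (λ j → x i - x j) + sum x              ∎
    positive : sum (λ j → x i - x j) # 0# ⊎ sum x # 0# → 0# < quadraticForm (laplacian G) x + sum x * sum x
    positive (inj₂ s#0) = nonneg+pos (laplacian-nonneg G x) (square-pos s#0)
    positive (inj₁ d#0) with j , dⱼ#0 ← sum-#0 (λ j → x i - x j) d#0
      with k , l , k~l , e#0 ← separating-edge G x (connected i j) dⱼ#0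
      = pos+nonneg (laplacian-pos G x k~l e#0) (square-nonneg (sum x))

  basis-*-≢ : ∀ (i j : Fin n) {x y} → ¬ (i ≡ x × j ≡ y) → basis i x * basis j y ≈ 0#
  basis-*-≢ i j {x} {y} differ with i ≟ x | j ≟ y
  ... | yes i≡x | yes j≡y = ⊥-elim (differ (i≡x , j≡y))
  ... | no _    | _       = zeroˡ _
  ... | yes _   | no _    = zeroʳ _

  module _ (F : EdgeSet n p) where
    open EdgeSet F

    private
      B = incidence F
      G = complete n ∖ F

    incidence-columnSum : ∀ α → sum (λ i → B i α) ≈ 0#
    incidence-columnSum α = trans (sum-distrib-- (basis (u α)) (basis (v α)))
      (trans (+-cong (sum-basis-one (u α)) (-‿cong (sum-basis-one (v α)))) (-‿inverseʳ 1#))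

    incidence-joins : ∀ {x y} → x ≢ y → ∀ α → Joins α x y → B x α * B y α ≈ - 1#
    incidence-joins x≢y α (inj₁ (≡.refl , ≡.refl)) = trans
      (*-cong (+-cong (basis-≡ (u α)) (-‿cong (basis-≢ (x≢y ∘ ≡.sym)))) (+-cong (basis-≢ x≢y) (-‿cong (basis-≡ (v α)))))
      (solve 0 ((con (pos 1) :- con (pos 0)) :* (con (pos 0) :- con (pos 1)) := con -1ℤ) refl)
    incidence-joins x≢y α (inj₂ (≡.refl , ≡.refl)) = trans
      (*-cong (+-cong (basis-≢ (x≢y ∘ ≡.sym)) (-‿cong (basis-≡ (v α)))) (+-cong (basis-≡ (u α)) (-‿cong (basis-≢ x≢y))))
      (solve 0 ((con (pos 0) :- con (pos 1)) :* (con (pos 1) :- con (pos 0)) := con -1ℤ) refl)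

    incidence-not-joins : ∀ {x y} → x ≢ y → ∀ α → ¬ Joins α x y → B x α * B y α ≈ 0#
    incidence-not-joins {x} {y} x≢y α ¬joins = begin
      (basis (u α) x - basis (v α) x) * (basis (u α) y - basis (v α) y)
        ≈⟨ solve 4 (λ a b c d → (a :- b) :* (c :- d) := a :* c :- a :* d :- c :* b :+ b :* d) refl
             (basis (u α) x) (basis (v α) x) (basis (u α) y) (basis (v α) y) ⟩
      basis (u α) x * basis (u α) y - basis (u α) x * basis (v α) y - basis (u α) y * basis (v α) x + basis (v α) x * basis (v α) y
        ≈⟨ +-cong (+-cong (+-cong
             (basis-*-≢ (u α) (u α) (λ { (≡.refl , u≡y) → x≢y u≡y }))
             (-‿cong (basis-*-≢ (u α) (v α) (¬joins ∘ inj₁))))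
             (-‿cong (basis-*-≢ (u α) (v α) (¬joins ∘ inj₂))))
             (basis-*-≢ (v α) (v α) (λ { (≡.refl , v≡y) → x≢y v≡y })) ⟩
      0# - 0# - 0# + 0#
        ≈⟨ solve 0 (con (pos 0) :- con (pos 0) :- con (pos 0) :+ con (pos 0) := con (pos 0)) refl ⟩
      0# ∎

    -- `distinct` tests α against the chosen orientation of β, so the reversed case is flipped
    -- first.
    joins-unique : ∀ {x y} α β → Joins α x y → Joins β x y → α ≡ β
    joins-unique α β jα (inj₁ (≡.refl , ≡.refl)) = distinct α β jα
    joins-unique α β jα (inj₂ (≡.refl , ≡.refl)) = distinct α β (flip jα)
      where
      flip : ∀ {x y} → Joins α x y → Joins α y x
      flip (inj₁ j) = inj₂ j
      flip (inj₂ j) = inj₁ j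

    joined? : ∀ x y → Dec (∃ λ α → Joins α x y)
    joined? x y = any? (λ α → ((u α ≟ x) ×-dec (v α ≟ y)) ⊎-dec ((u α ≟ y) ×-dec (v α ≟ x)))

    -- A deleted edge contributes -1 to B Bᵀ at its two off-diagonal positions and 0 at the others,
    -- and different deleted edges never meet at the same position.
    adjacency-complement : ∀ {x y} → x ≢ y → adjacency G x y ≈ 1# + (B *ᴹ transpose B) x y
    adjacency-complement {x} {y} x≢y = complement (joined? x y)
      where
      complement : Dec (∃ λ α → Joins α x y) → adjacency G x y ≈ 1# + (B *ᴹ transpose B) x y
      complement (yes (α , joins)) = begin
        adjacency G x y                   ≈⟨ indicator-no (SimpleGraph._~?_ G x y) (λ (_ , kept) → kept (α , joins)) ⟩
        0#                                ≈⟨ -‿inverseʳ 1# ⟨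
        1# - 1#                           ≈⟨ +-congˡ (incidence-joins x≢y α joins) ⟨
        1# + B x α * B y α                ≈⟨ +-congˡ (sum-single (λ β → B x β * B y β) α
                                               (λ β β≢α → incidence-not-joins x≢y β (λ joins′ → β≢α (joins-unique β α joins′ joins)))) ⟨
        1# + (B *ᴹ transpose B) x y       ∎
      complement (no ¬joined) = begin
        adjacency G x y                   ≈⟨ indicator-yes (SimpleGraph._~?_ G x y) (x≢y , ¬joined) ⟩
        1#                                ≈⟨ +-identityʳ 1# ⟨
        1# + 0#                           ≈⟨ +-congˡ (sum-zero (λ α → incidence-not-joins x≢y α (λ joins → ¬joined (α , joins)))) ⟨
        1# + (B *ᴹ transpose B) x y       ∎

  -- The difference of the two matrices lives on the diagonal and has zero row sums. Comparing row
  -- sums thus takes the place of counting degrees.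
  offDiagonal∧rowSums⇒≈ : {A B : Matrix n n} → (∀ {i j} → i ≢ j → A i j ≈ B i j) →
    (∀ i → sum (A i) ≈ sum (B i)) → A ≈ᴹ B
  offDiagonal∧rowSums⇒≈ {A = A} {B} off rows i j with i ≟ j
  ... | no i≢j     = off i≢j
  ... | yes ≡.refl = begin
    A i i                              ≈⟨ solve 2 (λ a b → a := a :- b :+ b) refl (A i i) (B i i) ⟩
    A i i - B i i + B i i              ≈⟨ +-congʳ (sum-single (λ j → A i j - B i j) i
                                            (λ j j≢i → trans (+-congʳ (off (j≢i ∘ ≡.sym))) (-‿inverseʳ _))) ⟨
    sum (λ j → A i j - B i j) + B i i  ≈⟨ +-congʳ (trans (sum-distrib-- (A i) (B i)) (trans (+-congʳ (rows i)) (-‿inverseʳ _))) ⟩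
    0# + B i i                         ≈⟨ +-identityˡ _ ⟩
    B i i                              ∎

  shiftedGram : EdgeSet n p → Matrix n n
  shiftedGram {n} F = fromℕ n ·ᴹ 1ᴹ -ᴹ incidence F *ᴹ transpose (incidence F)

  shiftedGram-sym : (F : EdgeSet n p) → transpose (shiftedGram F) ≈ᴹ shiftedGram F
  shiftedGram-sym F i j = +-cong (*-congˡ (basis-sym j i))
    (-‿cong (transpose-*ᴹ (incidence F) (transpose (incidence F)) i j))

  shiftedGram-rowSum : (F : EdgeSet n p) → ∀ i → sum (shiftedGram F i) ≈ fromℕ n
  shiftedGram-rowSum {n} {p} F i = begin
    sum (λ j → fromℕ n * 1ᴹ i j - (B *ᴹ transpose B) i j)
      ≈⟨ sum-distrib-- (λ j → fromℕ n * 1ᴹ i j) ((B *ᴹ transpose B) i) ⟩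
    sum (λ j → fromℕ n * 1ᴹ i j) - sum (λ j → sum (λ α → B i α * B j α))
      ≈⟨ +-cong (trans (sym (*-distribˡ-sum (fromℕ n) (1ᴹ i))) (*-congˡ (sum-basis-one i)))
           (-‿cong (trans (∑-comm {n} {p} (λ j α → B i α * B j α))
             (sum-zero (λ α → trans (sym (*-distribˡ-sum (B i α) (λ j → B j α)))
               (trans (*-congˡ (incidence-columnSum F α)) (zeroʳ _)))))) ⟩
    fromℕ n * 1# - 0#
      ≈⟨ solve 1 (λ n → n :* con (pos 1) :- con (pos 0) := n) refl (fromℕ n) ⟩
    fromℕ n ∎
    where
    B = incidence F

  -- Off the diagonal the two ones cancel in -(1 + B Bᵀ) + 1. Every row sums to n on both sides, as
  -- the rows of the Laplacian and the columns of B sum to 0.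
  laplacian+ones : (F : EdgeSet n p) → laplacian (complete n ∖ F) +ᴹ ones ≈ᴹ shiftedGram F
  laplacian+ones {n} F = offDiagonal∧rowSums⇒≈ {A = laplacian G +ᴹ ones} {B = shiftedGram F} off
    (λ i → trans (∑-distrib-+ (laplacian G i) (λ _ → 1#))
      (trans (+-cong (laplacian-rowSum G i) (sum-ones n)) (trans (+-identityˡ _) (sym (shiftedGram-rowSum F i)))))
    where
    G = complete n ∖ F
    B = incidence F
    off : ∀ {i j} → i ≢ j → laplacian G i j + 1# ≈ shiftedGram F i j
    off {i} {j} i≢j = begin
      degrees G i j - adjacency G i j + 1#
        ≈⟨ +-congʳ (+-cong (trans (if-then-0 (does (i ≟ j)) (sum (adjacency G i))) (*-congʳ (basis-≢ i≢j)))
             (-‿cong (adjacency-complement F i≢j))) ⟩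
      0# * sum (adjacency G i) - (1# + (B *ᴹ transpose B) i j) + 1#
        ≈⟨ solve 3 (λ d b n → con (pos 0) :* d :- (con (pos 1) :+ b) :+ con (pos 1) := n :* con (pos 0) :- b) refl
             (sum (adjacency G i)) ((B *ᴹ transpose B) i j) (fromℕ n) ⟩
      fromℕ n * 0# - (B *ᴹ transpose B) i j
        ≈⟨ +-congʳ (*-congˡ (basis-≢ i≢j)) ⟨
      shiftedGram F i j ∎

-- The deflated inverse, the Kirchhoff index as a trace, and the two formulas.

module KirchhoffIndices {c ℓ₁ ℓ₂ ℓ₃} (K : OrderedField c ℓ₁ ℓ₂ ℓ₃) where

  open OrderedField K hiding (zero; Carrier; _≈_; _#_; _+_; _*_; -_; _-_; 0#; 1#; #⇒invertible)
  open Over K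
  open OrderedFieldProperties K
  open Matrices K
  open Spectra K using (spectrum-resolvent)
  open PositiveDefiniteMatrices K
  open GraphLaplacians K
  open CommutativeRing commutativeRing using (semiring)
  open import Algebra.Properties.Semiring.Sum semiring
    using (sum-cong-≋; ∑-distrib-+; ∑-comm; *-distribˡ-sum; *-distribʳ-sum)
  open IntegerCoefficients commutativeRing using (module Solver)
  open Solver
  open ≈-Reasoning

  module _ {a a⁻¹ : Carrier} (aa⁻¹≈1 : a * a⁻¹ ≈ 1#) {N P : Matrix n n} (P-inverse : IsInverseᴹ N P)
    {J : Matrix n n} (Jᵀ≈J : transpose J ≈ᴹ J) (JJ≈aJ : J *ᴹ J ≈ᴹ a ·ᴹ J)
    (NJ≈aJ : N *ᴹ J ≈ᴹ a ·ᴹ J) (JN≈aJ : J *ᴹ N ≈ᴹ a ·ᴹ J)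
    {L : Matrix n n} (L≈N-J : L ≈ᴹ N -ᴹ J) where

    -- J / a is idempotent and N acts on its range as a, hence P as a⁻¹. Removing that part of P
    -- means subtracting a⁻¹ (J / a).
    deflatedInverse : Matrix n n
    deflatedInverse = P -ᴹ (a⁻¹ * a⁻¹) ·ᴹ J

    private
      X I-J/a : Matrix n n
      X = deflatedInverse
      I-J/a = 1ᴹ -ᴹ a⁻¹ ·ᴹ J

      PJ≈J/a : P *ᴹ J ≈ᴹ a⁻¹ ·ᴹ J
      PJ≈J/a i j = begin
        (P *ᴹ J) i j                  ≈⟨ trans (*-congʳ aa⁻¹≈1) (*-identityˡ _) ⟨
        a * a⁻¹ * (P *ᴹ J) i j        ≈⟨ solve 3 (λ a b x → a :* b :* x := b :* (a :* x)) refl a a⁻¹ _ ⟩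
        a⁻¹ * (a * (P *ᴹ J) i j)      ≈⟨ *-congˡ (*ᴹ-·ᴹ a P J i j) ⟨
        a⁻¹ * (P *ᴹ (a ·ᴹ J)) i j     ≈⟨ *-congˡ (*ᴹ-congˡ P NJ≈aJ i j) ⟨
        a⁻¹ * (P *ᴹ (N *ᴹ J)) i j     ≈⟨ *-congˡ (*ᴹ-assoc P N J i j) ⟨
        a⁻¹ * (P *ᴹ N *ᴹ J) i j       ≈⟨ *-congˡ (*ᴹ-congʳ J (proj₁ P-inverse) i j) ⟩
        a⁻¹ * (1ᴹ *ᴹ J) i j           ≈⟨ *-congˡ (*ᴹ-identityˡ J i j) ⟩
        a⁻¹ * J i j                   ∎

      JP≈J/a : J *ᴹ P ≈ᴹ a⁻¹ ·ᴹ J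
      JP≈J/a i j = begin
        (J *ᴹ P) i j                  ≈⟨ trans (*-congʳ aa⁻¹≈1) (*-identityˡ _) ⟨
        a * a⁻¹ * (J *ᴹ P) i j        ≈⟨ solve 3 (λ a b x → a :* b :* x := b :* (a :* x)) refl a a⁻¹ _ ⟩
        a⁻¹ * (a * (J *ᴹ P) i j)      ≈⟨ *-congˡ (·ᴹ-*ᴹ a J P i j) ⟨
        a⁻¹ * ((a ·ᴹ J) *ᴹ P) i j     ≈⟨ *-congˡ (*ᴹ-congʳ P JN≈aJ i j) ⟨
        a⁻¹ * (J *ᴹ N *ᴹ P) i j       ≈⟨ *-congˡ (*ᴹ-assoc J N P i j) ⟩
        a⁻¹ * (J *ᴹ (N *ᴹ P)) i j     ≈⟨ *-congˡ (*ᴹ-congˡ J (proj₂ P-inverse) i j) ⟩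
        a⁻¹ * (J *ᴹ 1ᴹ) i j           ≈⟨ *-congˡ (*ᴹ-identityʳ J i j) ⟩
        a⁻¹ * J i j                   ∎

      cancel : ∀ x → a⁻¹ * a⁻¹ * (a * x) ≈ a⁻¹ * x
      cancel x = trans (solve 3 (λ a b x → b :* b :* (a :* x) := a :* b :* (b :* x)) refl a a⁻¹ x)
        (trans (*-congʳ aa⁻¹≈1) (*-identityˡ _))

      *ᴹ-deflated : (Y : Matrix n n) → Y *ᴹ J ≈ᴹ a ·ᴹ J → Y *ᴹ X ≈ᴹ Y *ᴹ P -ᴹ a⁻¹ ·ᴹ J
      *ᴹ-deflated Y YJ≈aJ i j = trans (*ᴹ-distribˡ--ᴹ Y P ((a⁻¹ * a⁻¹) ·ᴹ J) i j)
        (+-congˡ (-‿cong (trans (*ᴹ-·ᴹ (a⁻¹ * a⁻¹) Y J i j) (trans (*-congˡ (YJ≈aJ i j)) (cancel (J i j))))))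

      deflated-*ᴹ : (Y : Matrix n n) → J *ᴹ Y ≈ᴹ a ·ᴹ J → X *ᴹ Y ≈ᴹ P *ᴹ Y -ᴹ a⁻¹ ·ᴹ J
      deflated-*ᴹ Y JY≈aJ i j = trans (*ᴹ-distribʳ--ᴹ Y P ((a⁻¹ * a⁻¹) ·ᴹ J) i j)
        (+-congˡ (-‿cong (trans (·ᴹ-*ᴹ (a⁻¹ * a⁻¹) J Y i j) (trans (*-congˡ (JY≈aJ i j)) (cancel (J i j))))))

      J*X≈0 : ∀ i j → (J *ᴹ X) i j ≈ 0#
      J*X≈0 i j = trans (*ᴹ-deflated J JJ≈aJ i j) (trans (+-congʳ (JP≈J/a i j)) (-‿inverseʳ _))

    deflatedInverse-*ᴹ-J : ∀ i j → (deflatedInverse *ᴹ J) i j ≈ 0#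
    deflatedInverse-*ᴹ-J i j = trans (deflated-*ᴹ J JJ≈aJ i j) (trans (+-congʳ (PJ≈J/a i j)) (-‿inverseʳ _))

    private
      LX≈I-J/a : L *ᴹ X ≈ᴹ I-J/a
      LX≈I-J/a i j = begin
        (L *ᴹ X) i j                          ≈⟨ *ᴹ-congʳ X L≈N-J i j ⟩
        ((N -ᴹ J) *ᴹ X) i j                   ≈⟨ *ᴹ-distribʳ--ᴹ X N J i j ⟩
        (N *ᴹ X) i j - (J *ᴹ X) i j           ≈⟨ +-cong (*ᴹ-deflated N NJ≈aJ i j) (-‿cong (J*X≈0 i j)) ⟩
        (N *ᴹ P) i j - a⁻¹ * J i j - 0#       ≈⟨ solve 2 (λ x y → x :- y :- con (pos 0) := x :- y) refl _ _ ⟩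
        (N *ᴹ P) i j - a⁻¹ * J i j            ≈⟨ +-congʳ (proj₂ P-inverse i j) ⟩
        1ᴹ i j - a⁻¹ * J i j                  ∎

      XL≈I-J/a : X *ᴹ L ≈ᴹ I-J/a
      XL≈I-J/a i j = begin
        (X *ᴹ L) i j                          ≈⟨ *ᴹ-congˡ X L≈N-J i j ⟩
        (X *ᴹ (N -ᴹ J)) i j                   ≈⟨ *ᴹ-distribˡ--ᴹ X N J i j ⟩
        (X *ᴹ N) i j - (X *ᴹ J) i j           ≈⟨ +-cong (deflated-*ᴹ N JN≈aJ i j) (-‿cong (deflatedInverse-*ᴹ-J i j)) ⟩
        (P *ᴹ N) i j - a⁻¹ * J i j - 0#       ≈⟨ solve 2 (λ x y → x :- y :- con (pos 0) := x :- y) refl _ _ ⟩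
        (P *ᴹ N) i j - a⁻¹ * J i j            ≈⟨ +-congʳ (proj₁ P-inverse i j) ⟩
        1ᴹ i j - a⁻¹ * J i j                  ∎

      J*L≈0 : ∀ i j → (J *ᴹ L) i j ≈ 0#
      J*L≈0 i j = trans (*ᴹ-congˡ J L≈N-J i j) (trans (*ᴹ-distribˡ--ᴹ J N J i j)
        (trans (+-cong (JN≈aJ i j) (-‿cong (JJ≈aJ i j))) (-‿inverseʳ _)))

      I-J/a-*ᴹ : (Y : Matrix n n) → (∀ i j → (J *ᴹ Y) i j ≈ 0#) → I-J/a *ᴹ Y ≈ᴹ Y
      I-J/a-*ᴹ Y JY≈0 i j = begin
        (I-J/a *ᴹ Y) i j                      ≈⟨ *ᴹ-distribʳ--ᴹ Y 1ᴹ (a⁻¹ ·ᴹ J) i j ⟩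
        (1ᴹ *ᴹ Y) i j - ((a⁻¹ ·ᴹ J) *ᴹ Y) i j ≈⟨ +-cong (*ᴹ-identityˡ Y i j) (-‿cong (trans (·ᴹ-*ᴹ a⁻¹ J Y i j) (*-congˡ (JY≈0 i j)))) ⟩
        Y i j - a⁻¹ * 0#                      ≈⟨ solve 2 (λ y b → y :- b :* con (pos 0) := y) refl _ _ ⟩
        Y i j                                 ∎

      I-J/a-symm : transpose I-J/a ≈ᴹ I-J/a
      I-J/a-symm i j = +-cong (basis-sym j i) (-‿cong (*-congˡ (Jᵀ≈J i j)))

    -- Both products with L equal the symmetric matrix 1 - J / a, which fixes L and X from the left
    -- because J annihilates both.
    deflatedInverse-moorePenrose : MoorePenroseInverse L
    deflatedInverse-moorePenrose = record
      { A⁺       = deflatedInverse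
      ; AA⁺A≈A   = ≈ᴹ.trans (*ᴹ-congʳ L LX≈I-J/a) (I-J/a-*ᴹ L J*L≈0)
      ; A⁺AA⁺≈A⁺ = ≈ᴹ.trans (*ᴹ-congʳ X XL≈I-J/a) (I-J/a-*ᴹ X J*X≈0)
      ; AA⁺-symm = ≈ᴹ.trans (transpose-cong LX≈I-J/a) (≈ᴹ.trans I-J/a-symm (≈ᴹ.sym LX≈I-J/a))
      ; A⁺A-symm = ≈ᴹ.trans (transpose-cong XL≈I-J/a) (≈ᴹ.trans I-J/a-symm (≈ᴹ.sym XL≈I-J/a))
      }

  -- Adding the sum with exchanged indices covers every ordered pair of distinct indices once, and
  -- the diagonal contributes 0.
  upperSum-double : (R : Matrix n n) → transpose R ≈ᴹ R → (∀ i → R i i ≈ 0#) →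
    let S = sum (λ i → sum (λ j → if does (i <? j) then R i j else 0#)) in
    S + S ≈ sum (λ i → sum (R i))
  upperSum-double {n} R Rᵀ≈R diag = begin
    sum (λ i → sum (upper i)) + sum (λ i → sum (upper i))
      ≈⟨ +-congˡ (∑-comm upper) ⟩
    sum (λ i → sum (upper i)) + sum (λ i → sum (λ j → upper j i))
      ≈⟨ ∑-distrib-+ (λ i → sum (upper i)) (λ i → sum (λ j → upper j i)) ⟨
    sum (λ i → sum (upper i) + sum (λ j → upper j i))
      ≈⟨ sum-cong-≋ (λ i → trans (sym (∑-distrib-+ (upper i) (λ j → upper j i))) (sum-cong-≋ (split i))) ⟩
    sum (λ i → sum (R i)) ∎
    where
    upper : Matrix n n
    upper i j = if does (i <? j) then R i j else 0#
    split : ∀ i j → upper i j + upper j i ≈ R i j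
    split i j with <-cmp i j
    ... | tri< i<j _ j≮i rewrite dec-true (i <? j) i<j | dec-false (j <? i) j≮i = +-identityʳ _
    ... | tri> i≮j _ j<i rewrite dec-false (i <? j) i≮j | dec-true (j <? i) j<i = trans (+-identityˡ _) (Rᵀ≈R i j)
    ... | tri≈ i≮j ≡.refl _ rewrite dec-false (i <? i) i≮j = trans (+-identityˡ 0#) (sym (diag i))

  sum-basis-difference : (x y : Fin n) (f : Vector Carrier n) → sum (λ i → (basis x i - basis y i) * f i) ≈ f x - f y
  sum-basis-difference x y f = trans
    (sum-cong-≋ (λ i → solve 3 (λ a b f → (a :- b) :* f := a :* f :- b :* f) refl (basis x i) (basis y i) (f i)))
    (trans (sum-distrib-- (λ i → basis x i * f i) (λ i → basis y i * f i)) (+-cong (sum-basis x f) (-‿cong (sum-basis y f))))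

  module _ (G : SimpleGraph n) (L⁺ : MoorePenroseInverse (laplacian G)) where
    open MoorePenroseInverse L⁺

    resistance-entries : ∀ x y → resistance G L⁺ x y ≈ A⁺ x x - A⁺ x y - (A⁺ y x - A⁺ y y)
    resistance-entries x y = begin
      sum (λ i → sum (λ j → d i * A⁺ i j * d j))
        ≈⟨ sum-cong-≋ (λ i → trans (sum-cong-≋ (λ j → *-comm (d i * A⁺ i j) (d j)))
             (trans (sum-basis-difference x y (λ j → d i * A⁺ i j))
               (solve 3 (λ d a b → d :* a :- d :* b := d :* (a :- b)) refl (d i) (A⁺ i x) (A⁺ i y)))) ⟩
      sum (λ i → d i * (A⁺ i x - A⁺ i y))
        ≈⟨ sum-basis-difference x y (λ i → A⁺ i x - A⁺ i y) ⟩
      A⁺ x x - A⁺ x y - (A⁺ y x - A⁺ y y) ∎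
      where
      d = λ i → basis x i - basis y i

    -- Twice the index is the sum of the resistances over all ordered pairs. There the diagonal
    -- entries of `A⁺` contribute n tr `A⁺` twice, and the mixed entries remove the total of all
    -- entries twice.
    kirchhoffIndex-trace : kirchhoffIndex G L⁺ ≈ fromℕ n * tr A⁺ - sum (λ i → sum (A⁺ i))
    kirchhoffIndex-trace = double-cancel (begin
      kirchhoffIndex G L⁺ + kirchhoffIndex G L⁺
        ≈⟨ upperSum-double (resistance G L⁺) symmetric diagonal ⟩
      sum (λ x → sum (λ y → resistance G L⁺ x y))
        ≈⟨ sum-cong-≋ (λ x → trans (sum-cong-≋ (resistance-entries x)) (rows x)) ⟩
      sum (λ x → fromℕ n * A⁺ x x - sum (A⁺ x) - (sum (λ y → A⁺ y x) - tr A⁺))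
        ≈⟨ sum-distrib-- (λ x → fromℕ n * A⁺ x x - sum (A⁺ x)) (λ x → sum (λ y → A⁺ y x) - tr A⁺) ⟩
      sum (λ x → fromℕ n * A⁺ x x - sum (A⁺ x)) - sum (λ x → sum (λ y → A⁺ y x) - tr A⁺)
        ≈⟨ +-cong (trans (sum-distrib-- (λ x → fromℕ n * A⁺ x x) (λ x → sum (A⁺ x)))
                    (+-congʳ (sym (*-distribˡ-sum (fromℕ n) (λ x → A⁺ x x)))))
             (-‿cong (trans (sum-distrib-- (λ x → sum (λ y → A⁺ y x)) (λ _ → tr A⁺))
               (+-cong (sym (∑-comm A⁺)) (-‿cong (sum-const (tr A⁺)))))) ⟩
      fromℕ n * tr A⁺ - total - (total - fromℕ n * tr A⁺)
        ≈⟨ solve 2 (λ t s → t :- s :- (s :- t) := t :- s :+ (t :- s)) refl (fromℕ n * tr A⁺) total ⟩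
      fromℕ n * tr A⁺ - total + (fromℕ n * tr A⁺ - total) ∎)
      where
      total = sum (λ i → sum (A⁺ i))
      sum-const : ∀ x → sum {n} (λ _ → x) ≈ fromℕ n * x
      sum-const x = trans (sum-cong-≋ {n} (λ _ → sym (*-identityˡ x)))
        (trans (sym (*-distribʳ-sum x (λ (_ : Fin n) → 1#))) (*-congʳ (sum-ones n)))
      rows : ∀ x → sum (λ y → A⁺ x x - A⁺ x y - (A⁺ y x - A⁺ y y)) ≈
        fromℕ n * A⁺ x x - sum (A⁺ x) - (sum (λ y → A⁺ y x) - tr A⁺)
      rows x = trans (sum-distrib-- (λ y → A⁺ x x - A⁺ x y) (λ y → A⁺ y x - A⁺ y y))
        (+-cong (trans (sum-distrib-- (λ _ → A⁺ x x) (A⁺ x)) (+-congʳ (sum-const (A⁺ x x))))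
          (-‿cong (sum-distrib-- (λ y → A⁺ y x) (λ y → A⁺ y y))))
      symmetric : ∀ x y → resistance G L⁺ y x ≈ resistance G L⁺ x y
      symmetric x y = trans (resistance-entries y x) (trans
        (solve 4 (λ xx xy yx yy → yy :- yx :- (xy :- xx) := xx :- xy :- (yx :- yy)) refl (A⁺ x x) (A⁺ x y) (A⁺ y x) (A⁺ y y))
        (sym (resistance-entries x y)))
      diagonal : ∀ x → resistance G L⁺ x x ≈ 0#
      diagonal x = trans (resistance-entries x x)
        (solve 1 (λ a → a :- a :- (a :- a) := con (pos 0)) refl (A⁺ x x))

  -- (a - A) M⁻¹ = 1 says A M⁻¹ = a M⁻¹ - 1. With the scalar version `sum-resolvent` this reduces
  -- the spectral formula to tr M⁻¹, as the same size is subtracted in both.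
  trace-resolvent : (A : Matrix n n) → ∀ a {M⁻¹} → (a ·ᴹ 1ᴹ -ᴹ A) *ᴹ M⁻¹ ≈ᴹ 1ᴹ →
    tr (A *ᴹ M⁻¹) ≈ a * tr M⁻¹ - fromℕ n
  trace-resolvent {n} A a {M⁻¹} MM⁻¹≈1 = begin
    tr (A *ᴹ M⁻¹)                       ≈⟨ tr-cong (λ i j → begin
      (A *ᴹ M⁻¹) i j
        ≈⟨ solve 2 (λ x y → x := y :- (y :- x)) refl _ (a * M⁻¹ i j) ⟩
      a * M⁻¹ i j - (a * M⁻¹ i j - (A *ᴹ M⁻¹) i j)
        ≈⟨ +-congˡ (-‿cong (trans (sym (expand i j)) (MM⁻¹≈1 i j))) ⟩
      a * M⁻¹ i j - 1ᴹ i j ∎) ⟩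
    tr (a ·ᴹ M⁻¹ -ᴹ 1ᴹ)                 ≈⟨ tr--ᴹ (a ·ᴹ M⁻¹) 1ᴹ ⟩
    tr (a ·ᴹ M⁻¹) - tr (1ᴹ {n})         ≈⟨ +-cong (tr-·ᴹ a M⁻¹) (-‿cong (tr-1ᴹ n)) ⟩
    a * tr M⁻¹ - fromℕ n                ∎
    where
    expand : (a ·ᴹ 1ᴹ -ᴹ A) *ᴹ M⁻¹ ≈ᴹ a ·ᴹ M⁻¹ -ᴹ A *ᴹ M⁻¹
    expand i j = trans (*ᴹ-distribʳ--ᴹ M⁻¹ (a ·ᴹ 1ᴹ) A i j)
      (+-congʳ (trans (·ᴹ-*ᴹ a 1ᴹ M⁻¹ i j) (*-congˡ (*ᴹ-identityˡ M⁻¹ i j))))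

  sum-resolvent : ∀ a (θ : Vector Carrier p) (a#θ : ∀ α → a # θ α) →
    sum (λ α → θ α * recip-diff (a#θ α)) ≈ a * sum (λ α → recip-diff (a#θ α)) - fromℕ p
  sum-resolvent {p} a θ a#θ = begin
    sum (λ α → θ α * μ α)               ≈⟨ sum-cong-≋ (λ α → trans
                                             (solve 3 (λ a t m → t :* m := a :* m :- (a :- t) :* m) refl a (θ α) (μ α))
                                             (+-congˡ (-‿cong (recip-diff-inverse (a#θ α))))) ⟩
    sum (λ α → a * μ α - 1#)            ≈⟨ sum-distrib-- (λ α → a * μ α) (λ _ → 1#) ⟩
    sum (λ α → a * μ α) - sum {p} (λ _ → 1#)
                                        ≈⟨ +-cong (sym (*-distribˡ-sum a μ)) (-‿cong (sum-ones p)) ⟩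
    a * sum μ - fromℕ p                 ∎
    where
    μ = λ α → recip-diff (a#θ α)

  module _ (F : EdgeSet n p) {ν⁻¹ : Carrier} (νν⁻¹≈1 : fromℕ n * ν⁻¹ ≈ 1#) where
    private
      B = incidence F
      Bᵀ = transpose B
      Q = edgeDefect F
      G = complete n ∖ F
      ν = fromℕ n
      M = ν ·ᴹ 1ᴹ -ᴹ Q
      N = shiftedGram F
      J : Matrix n n
      J = ones

    -- Connectedness enters here: the definite matrix L(G) + J is N = ν - B Bᵀ, and
    -- `complementary-inverse` carries its invertibility over to ν - BᵀB.
    edgeDefect-invertible : Connected G → Invertibleᴹ M
    edgeDefect-invertible connected = _ , complementary-inverse νν⁻¹≈1 B Bᵀ
      (positiveDefinite-invertible {A = N} (shiftedGram-sym F) (λ x i xᵢ#0 →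
        <.<-respʳ-≈ (quadraticForm-cong (laplacian+ones F) x) (connected⇒positiveDefinite G connected x i xᵢ#0)))

    -- From here on M⁻¹ is an arbitrary inverse of M, and the inverse P of N is rebuilt from it, so
    -- that the trace is expressed through this M⁻¹.
    module _ (M⁻¹-inverse : Invertibleᴹ M) where
      private
        M⁻¹ = proj₁ M⁻¹-inverse
        P = ν⁻¹ ·ᴹ (1ᴹ +ᴹ B *ᴹ M⁻¹ *ᴹ Bᵀ)

        NJ≈νJ : N *ᴹ J ≈ᴹ ν ·ᴹ J
        NJ≈νJ i j = trans (sum-cong-≋ (λ k → *-identityʳ (N i k))) (trans (shiftedGram-rowSum F i) (sym (*-identityʳ ν)))

        JN≈νJ : J *ᴹ N ≈ᴹ ν ·ᴹ J
        JN≈νJ i j = trans (sum-cong-≋ (λ k → trans (*-identityˡ (N k j)) (shiftedGram-sym F j k)))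
          (trans (shiftedGram-rowSum F j) (sym (*-identityʳ ν)))

        JJ≈νJ : J *ᴹ J ≈ᴹ ν ·ᴹ J
        JJ≈νJ i j = trans (sum-cong-≋ {n} (λ k → *-identityʳ 1#)) (trans (sum-ones n) (sym (*-identityʳ ν)))

        L≈N-J : laplacian G ≈ᴹ N -ᴹ J
        L≈N-J i j = trans (solve 1 (λ l → l := l :+ con (pos 1) :- con (pos 1)) refl (laplacian G i j))
          (+-congʳ (laplacian+ones F i j))

        P-inverse : IsInverseᴹ N P
        P-inverse = complementary-inverse νν⁻¹≈1 Bᵀ B M⁻¹-inverse

        X : Matrix n n
        X = deflatedInverse {a⁻¹ = ν⁻¹} νν⁻¹≈1 {P = P} P-inverse {J} (λ _ _ → refl) JJ≈νJ NJ≈νJ JN≈νJ L≈N-J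

      laplacian-moorePenrose : MoorePenroseInverse (laplacian G)
      laplacian-moorePenrose = deflatedInverse-moorePenrose νν⁻¹≈1 {P = P} P-inverse (λ _ _ → refl) JJ≈νJ NJ≈νJ JN≈νJ L≈N-J

      private
        X-total : sum (λ i → sum (X i)) ≈ 0#
        X-total = sum-zero (λ i → trans (sum-cong-≋ (λ j → sym (*-identityʳ (X i j))))
          (deflatedInverse-*ᴹ-J νν⁻¹≈1 {P = P} P-inverse (λ _ _ → refl) JJ≈νJ NJ≈νJ JN≈νJ L≈N-J i i))

        -- J / ν² has trace 1 / ν, hence the -1 after scaling by ν. Cyclicity of the trace turns B
        -- M⁻¹ Bᵀ into Q M⁻¹, and the identity summand contributes ν.
        X-trace : ν * tr X ≈ (ν - 1#) + tr (Q *ᴹ M⁻¹)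
        X-trace = begin
          ν * tr X
            ≈⟨ *-congˡ (tr--ᴹ P ((ν⁻¹ * ν⁻¹) ·ᴹ J)) ⟩
          ν * (tr P - tr ((ν⁻¹ * ν⁻¹) ·ᴹ J))
            ≈⟨ *-congˡ (+-cong (tr-·ᴹ ν⁻¹ (1ᴹ +ᴹ B *ᴹ M⁻¹ *ᴹ Bᵀ))
                 (-‿cong (trans (tr-·ᴹ (ν⁻¹ * ν⁻¹) J) (*-congˡ (sum-ones n))))) ⟩
          ν * (ν⁻¹ * tr (1ᴹ +ᴹ B *ᴹ M⁻¹ *ᴹ Bᵀ) - ν⁻¹ * ν⁻¹ * ν)
            ≈⟨ solve 3 (λ n r t → n :* (r :* t :- r :* r :* n) := n :* r :* t :- n :* r :* (n :* r)) refl ν ν⁻¹ _ ⟩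
          ν * ν⁻¹ * tr (1ᴹ +ᴹ B *ᴹ M⁻¹ *ᴹ Bᵀ) - ν * ν⁻¹ * (ν * ν⁻¹)
            ≈⟨ +-cong (*-congʳ νν⁻¹≈1) (-‿cong (*-cong νν⁻¹≈1 νν⁻¹≈1)) ⟩
          1# * tr (1ᴹ +ᴹ B *ᴹ M⁻¹ *ᴹ Bᵀ) - 1# * 1#
            ≈⟨ +-congʳ (*-congˡ (trans (tr-+ᴹ 1ᴹ (B *ᴹ M⁻¹ *ᴹ Bᵀ)) (+-cong (tr-1ᴹ n)
                 (trans (tr-*ᴹ-comm (B *ᴹ M⁻¹) Bᵀ) (tr-cong (≈ᴹ.sym (*ᴹ-assoc Bᵀ B M⁻¹))))))) ⟩
          1# * (ν + tr (Q *ᴹ M⁻¹)) - 1# * 1#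
            ≈⟨ solve 2 (λ n t → con (pos 1) :* (n :+ t) :- con (pos 1) :* con (pos 1) := n :- con (pos 1) :+ t) refl ν (tr (Q *ᴹ M⁻¹)) ⟩
          (ν - 1#) + tr (Q *ᴹ M⁻¹) ∎

      -- The trace is computed for the explicit X; uniqueness of the Moore-Penrose inverse transfers
      -- it to the given `L⁺`.
      kirchhoffIndex-edgeDefect : (L⁺ : MoorePenroseInverse (laplacian G)) →
        kirchhoffIndex G L⁺ ≈ (ν - 1#) + tr (Q *ᴹ M⁻¹)
      kirchhoffIndex-edgeDefect L⁺ = begin
        kirchhoffIndex G L⁺                     ≈⟨ kirchhoffIndex-trace G L⁺ ⟩
        ν * tr A⁺ - sum (λ i → sum (A⁺ i))      ≈⟨ +-cong (*-congˡ (tr-cong A⁺≈X)) (-‿cong (trans (sum-cong-≋ (λ i → sum-cong-≋ (A⁺≈X i))) X-total)) ⟩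
        ν * tr X - 0#                           ≈⟨ solve 1 (λ x → x :- con (pos 0) := x) refl _ ⟩
        ν * tr X                                ≈⟨ X-trace ⟩
        (ν - 1#) + tr (Q *ᴹ M⁻¹)                ∎
        where
        open MoorePenroseInverse L⁺
        A⁺≈X : A⁺ ≈ᴹ X
        A⁺≈X = moorePenrose-unique L⁺ laplacian-moorePenrose

      kirchhoffIndex-spectrum : (L⁺ : MoorePenroseInverse (laplacian G)) → ∀ {θ} → IsSpectrum Q θ →
        Σ[ n#θ ∈ (∀ α → ν # θ α) ]
          kirchhoffIndex G L⁺ ≈ (ν - 1#) + sum (λ α → θ α * recip-diff (n#θ α))
      kirchhoffIndex-spectrum L⁺ {θ} spectrum = n#θ , (begin
        kirchhoffIndex G L⁺                                        ≈⟨ kirchhoffIndex-edgeDefect L⁺ ⟩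
        (ν - 1#) + tr (Q *ᴹ M⁻¹)                                   ≈⟨ +-congˡ (trace-resolvent Q ν (proj₂ (proj₂ M⁻¹-inverse))) ⟩
        (ν - 1#) + (ν * tr M⁻¹ - fromℕ p)                          ≈⟨ +-congˡ (+-congʳ (*-congˡ (proj₂ resolvent))) ⟩
        (ν - 1#) + (ν * sum (λ α → recip-diff (n#θ α)) - fromℕ p)  ≈⟨ +-congˡ (sum-resolvent ν θ n#θ) ⟨
        (ν - 1#) + sum (λ α → θ α * recip-diff (n#θ α))            ∎)
        where
        resolvent = spectrum-resolvent spectrum M⁻¹-inverse
        n#θ = proj₁ resolvent

theorem4p1 : ∀ {c ℓ₁ ℓ₂ ℓ₃} (K : OrderedField c ℓ₁ ℓ₂ ℓ₃) → let open Over K in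
    ∀ (n p : ℕ) (F : EdgeSet n p) → 1 ≤ p →
    let G = complete n ∖ F
        Q = edgeDefect F
        M = fromℕ n ·ᴹ 1ᴹ -ᴹ Q
    in
    Connected G →
    MoorePenroseInverse (laplacian G) ×
    Invertibleᴹ M ×
    (∀ (L⁺ : MoorePenroseInverse (laplacian G)) →
      (∀ (M⁻¹ : Invertibleᴹ M) →
        kirchhoffIndex G L⁺ ≈ (fromℕ n - 1#) + tr (Q *ᴹ proj₁ M⁻¹)) ×
      (∀ (θ : Vector Carrier p) → IsSpectrum Q θ →
        Σ[ n#θ ∈ (∀ α → fromℕ n # θ α) ]
          kirchhoffIndex G L⁺ ≈ (fromℕ n - 1#) + sum (λ α → θ α * recip-diff (n#θ α))))
-- Invertibility of ν needs n to be positive. Since p is at least 1, there is an edge, and its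
-- endpoint excludes the empty vertex set.
theorem4p1 K zero    (suc p) F 1≤p connected with () ← EdgeSet.u F zero
theorem4p1 K (suc n) p       F 1≤p connected =
  laplacian-moorePenrose F νν⁻¹≈1 M-invertible ,
  M-invertible ,
  λ L⁺ →
    (λ M⁻¹ → kirchhoffIndex-edgeDefect F νν⁻¹≈1 M⁻¹ L⁺) ,
    (λ θ spectrum → kirchhoffIndex-spectrum F νν⁻¹≈1 M-invertible L⁺ spectrum)
  where
  open Over K
  open KirchhoffIndices K
  νν⁻¹≈1 = proj₂ (OrderedFieldProperties.fromℕ-unit K (suc n))
  M-invertible = edgeDefect-invertible F νν⁻¹≈1 connected
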